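{- Let $H$ be a finite group of order prime to $p$, and let $\mathbb{F}_q$ be a finite field of characteristic $p$ containing the $|H|$-th roots of unity. Let $Y$ be a smooth projective connected curve over $\mathbb{F}_q$ on which $H$ acts faithfully by $\mathbb{F}_q$-automorphisms (so $Y\to Y/H$ is a Galois cover with group $H$). Suppose $\sum_M s_{\chi_M}e_{\chi_M}=0$ in $\mathbb{C}[H]$, where $M$ runs through the subgroups of $H$, for each $M$ an irreducible character $\chi_M$ of $M$ is chosen, and $s_{\chi_M}\in\mathbb{Z}$. Then $$\prod_M P(t,\chi_M^{ -1},Y/Y_M)^{\chi_M(1)s_{\chi_M}}=1,$$ where $Y_M=Y/M$ is the quotient curve and $Y\to Y_M$ the corresponding Galois cover with group $M$.
   Context: The $|H|$-th roots of unity in $\mathbb{C}$ are identified with those in $\mathbb{F}_q$ (and with those in $\mathbb{C}_\ell$ for primes $\ell\neq p$) so characters can be evaluated compatibly. For a subgroup $M\le H$ and an irreducible (complex) character $\chi_M$ of $M$, the idempotent is $e_{\chi_M}=\frac{\chi_M(1)}{|M|}\sum_{\sigma\in M}\chi_M(\sigma^{ -1})\sigma\in\mathbb{C}[H]$; $\chi^{ -1}$ denotes the character of $\tau\mapsto\rho_\chi(\tau)^{ -1}$, where $\rho_\chi$ is a representation affording $\chi$. For a Galois cover $Y\to X=Y/M$ with group $M$ over $\mathbb{F}_q$ and an irreducible character $\chi$ of $M$: let $F$ be the geometric $q$-Frobenius of $Y$, and for $\nu\ge1$, $\tau\in M$ let $\Lambda(\tau\circ F^\nu)$ be the number of points of $Y$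 (over $\overline{\mathbb{F}}_q$) fixed by $\tau\circ F^\nu$. The Artin $L$-function is $L(t,\chi,Y/X)=\exp\big(\sum_{\nu\ge1}A_\nu(\chi)t^\nu/\nu\big)$ with $A_\nu(\chi)=\frac1{|M|}\sum_{\tau\in M}\chi(\tau^{ -1})\Lambda(\tau\circ F^\nu)$. Then $P(t,\chi,Y/X)$ is the polynomial defined by $L(t,\chi,Y/X)=P(t,\chi,Y/X)/\big((1-qt)^{u_\chi}(1-t)^{u_\chi}\big)$, where $u_\chi=1$ if $\chi$ is trivial and $u_\chi=0$ otherwise. Equivalently, for a prime $\ell\ne p$, with $\alpha^*_\tau$ the action of $\tau$ and $\alpha^*_{F^\nu}$ that of $F^\nu$ on the $\ell$-adic Tate module $T_\ell(J_Y)$ of the Jacobian, $P(t,\chi,Y/X)=\exp\big(\sum_{\nu\ge1}-\frac1{|M|}\sum_{\tau\in M}\chi(\tau^{ -1})\mathrm{Tr}(\alpha^*_{\tau^{ -1}}\circ\alpha^*_{F^\nu}\mid T_\ell(J_Y))\,t^\nu/\nu\big)$. -}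

module Defs where

open import Level using (0ℓ)
open import Algebra.Apartness.Bundles using (HeytingCommutativeRing; HeytingField)
import Algebra.Apartness.Properties.HeytingCommutativeRing as HeytingProperties
open import Algebra.Bundles using (CommutativeRing; Group)
import Algebra.Consequences.Setoid as Consequences
open import Algebra.Morphism.Structures using (IsRingHomomorphism)
import Algebra.Properties.CommutativeMonoid.Sum as MonoidSum
import Algebra.Properties.Semiring.Exp as SemiringExp
import Algebra.Properties.Semiring.Mult as SemiringMult
import Algebra.Properties.Semiring.Sum as SemiringSum
import Algebra.Solver.Ring.NaturalCoefficients.Default as SemiringSolver
open import Algebra.Structures using (IsCommutativeRing)
open import Data.Bool.Base using (if_then_else_)
import Data.Fin.Base as Fin
import Data.Fin.Properties as Fin
open import Data.Fin.Base using (Fin; zero; suc)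
import Data.Fin.Subset as Subset
open Subset using (Subset; inside; outside; _∈_)
open import Data.Fin.Subset.Properties as SubsetP using (_∈?_)
open import Data.Integer.Base using (ℤ; +_; -[1+_])
open import Data.List.Base as List using (List; []; _∷_)
open import Data.List.Relation.Unary.All using (All)
import Data.Maybe.Base as Maybe
open import Data.Nat.Base as ℕ using (ℕ; zero; suc; _⊔_; _∸_; _!)
  renaming (_≤_ to _≤ℕ_)
import Data.Nat.Properties as ℕP
open import Data.Nat.Properties using (_!≢0)
open import Data.Product.Base using (_×_; _,_; proj₁; proj₂; ∃; ∃-syntax; Σ-syntax)
import Data.Rational.Base as ℚ
open ℚ using (0ℚ; 1ℚ; ½) renaming (ℚ to Rational)
import Data.Rational.Properties as ℚP
import Data.Rational.Solver as ℚS
open import Data.Sum.Base using (_⊎_)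
open import Data.Vec.Base using ([]; _∷_)
open import Function.Bundles using (Inverse)
open import Relation.Binary.Bundles using (Setoid)
open import Relation.Binary.PropositionalEquality.Core as ≡ using (_≡_)
import Relation.Binary.PropositionalEquality.Properties as ≡
open import Relation.Binary.Structures using (IsEquivalence)
open import Relation.Nullary.Decidable
  using (Dec; yes; no; does; dec⇒maybe; _×-dec_; _→-dec_)
open import Relation.Nullary.Negation using (¬_)

private module ℕSum = MonoidSum ℕP.+-0-commutativeMonoid

module Estimates where
  open ℚ using (_+_; _*_; _-_; -_; ∣_∣; _<_; _≤_; Positive)
  open ℚS.+-*-Solver using (solve; _:=_; _:+_; _:*_; :-_; _:-_; con)

  ½-pos : ∀ {ε} → 0ℚ < ε → 0ℚ < ε * ½
  ½-pos {ε} p = ℚP.positive⁻¹ (ε * ½)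
    where instance
      _ : Positive ε
      _ = ℚ.positive p
      _ : Positive (ε * ½)
      _ = ℚP.pos*pos⇒pos ε ½

  halves : ∀ ε → ε * ½ + ε * ½ ≡ ε
  halves ε = ≡.trans (≡.sym (ℚP.*-distribˡ-+ ε ½ ½)) (ℚP.*-identityʳ ε)

  small-+ : ∀ {ε} a b → ∣ a ∣ < ε * ½ → ∣ b ∣ < ε * ½ → ∣ a + b ∣ < ε
  small-+ {ε} a b a< b< =
    ℚP.≤-<-trans (ℚP.∣p+q∣≤∣p∣+∣q∣ a b)
      (≡.subst (∣ a ∣ + ∣ b ∣ <_) (halves ε) (ℚP.+-mono-< a< b<))

  swap : ∀ a b → ∣ a - b ∣ ≡ ∣ b - a ∣
  swap a b = ≡.trans (≡.sym (ℚP.∣-p∣≡∣p∣ (a - b)))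
    (≡.cong ∣_∣ (solve 2 (λ a b → :- (a :- b) := b :- a) ≡.refl a b))

  triangle : ∀ {ε} a b c → ∣ a - b ∣ < ε * ½ → ∣ b - c ∣ < ε * ½ → ∣ a - c ∣ < ε
  triangle {ε} a b c p q =
    ≡.subst (λ t → ∣ t ∣ < ε)
      (solve 3 (λ a b c → (a :- b) :+ (b :- c) := a :- c) ≡.refl a b c)
      (small-+ (a - b) (b - c) p q)

  difference-+ : ∀ {ε} a b c d → ∣ a - b ∣ < ε * ½ → ∣ c - d ∣ < ε * ½ →
                 ∣ (a + c) - (b + d) ∣ < ε
  difference-+ {ε} a b c d p q =
    ≡.subst (λ t → ∣ t ∣ < ε)
      (solve 4 (λ a b c d → (a :- b) :+ (c :- d) := (a :+ c) :- (b :+ d)) ≡.refl a b c d)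
      (small-+ (a - b) (c - d) p q)

  difference-neg : ∀ a b → ∣ (- a) - (- b) ∣ ≡ ∣ a - b ∣
  difference-neg a b = ≡.trans
    (≡.cong ∣_∣ (solve 2 (λ a b → (:- a) :- (:- b) := :- (a :- b)) ≡.refl a b))
    (ℚP.∣-p∣≡∣p∣ (a - b))

  near-bound : ∀ a b → ∣ a - b ∣ < 1ℚ → ∣ a ∣ < 1ℚ + ∣ b ∣
  near-bound a b p = ℚP.≤-<-trans
    (≡.subst (λ t → ∣ t ∣ ≤ ∣ a - b ∣ + ∣ b ∣)
      (solve 2 (λ a b → (a :- b) :+ b := a) ≡.refl a b) (ℚP.∣p+q∣≤∣p∣+∣q∣ (a - b) b))
    (ℚP.+-mono-<-≤ p (ℚP.≤-refl {∣ b ∣}))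

  bound-pos : ∀ b → 0ℚ < 1ℚ + ∣ b ∣
  bound-pos b = ℚP.+-mono-<-≤ (ℚP.positive⁻¹ 1ℚ) (ℚP.0≤∣p∣ b)

  tolerance : ∀ {ε B} → 0ℚ < ε → 0ℚ < B → ∃[ δ ] 0ℚ < δ × B * δ ≡ ε
  tolerance {ε} {B} ε> B> = (1/B * ε) , ℚP.positive⁻¹ (1/B * ε) , eq
    where
      instance
        _ : Positive ε
        _ = ℚ.positive ε>
        B+ : Positive B
        B+ = ℚ.positive B>
      1/B : Rational
      1/B = (ℚ.1/ B) {{ℚP.pos⇒nonZero B}}
      instance
        1/B+ : Positive 1/B
        1/B+ = ℚP.1/pos⇒pos B
        _ : Positive (1/B * ε)
        _ = ℚP.pos*pos⇒pos 1/B ε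
      eq : B * (1/B * ε) ≡ ε
      eq = ≡.trans (≡.sym (ℚP.*-assoc B 1/B ε))
          (≡.trans (≡.cong (_* ε) (ℚP.*-inverseʳ B {{ℚP.pos⇒nonZero B}})) (ℚP.*-identityˡ ε))

  small-* : ∀ {B δ ε} a b → 0ℚ < B → ∣ a ∣ < B → B * δ ≡ ε → ∣ b ∣ < δ → ∣ a * b ∣ < ε
  small-* {B} {δ} {ε} a b B> a< refl′ b< =
    ≡.subst (_< ε) (≡.sym (ℚP.∣p*q∣≡∣p∣*∣q∣ a b))
      (ℚP.≤-<-trans
        (ℚP.*-monoʳ-≤-nonNeg ∣ b ∣ {{ℚP.∣-∣-nonNeg b}} (ℚP.<⇒≤ a<))
        (≡.subst (B * ∣ b ∣ <_) refl′
          (ℚP.*-monoʳ-<-pos B {{ℚ.positive B>}} b<)))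

  difference-* : ∀ {ε B C δ δ′} a b c d → 0ℚ < B → 0ℚ < C →
                 B * δ ≡ ε * ½ → C * δ′ ≡ ε * ½ → ∣ a ∣ < B → ∣ d ∣ < C →
                 ∣ c - d ∣ < δ → ∣ a - b ∣ < δ′ → ∣ a * c - b * d ∣ < ε
  difference-* {ε} a b c d B> C> eqB eqC a< d< cd ab =
    ≡.subst (λ t → ∣ t ∣ < ε)
      (solve 4 (λ a b c d → (a :* (c :- d)) :+ (d :* (a :- b)) := (a :* c) :- (b :* d))
         ≡.refl a b c d)
      (small-+ (a * (c - d)) (d * (a - b))
        (small-* a (c - d) B> a< eqB cd) (small-* d (a - b) C> d< eqC ab))

Cauchy : (ℕ → Rational) → Set
Cauchy s = ∀ ε → 0ℚ ℚ.< ε → ∃[ N ] ∀ m n → N ≤ℕ m → N ≤ℕ n → ℚ.∣ s m ℚ.- s n ∣ ℚ.< ε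

-- Equality of real numbers is _≈ℝ_, not _≡_.
record ℝ : Set where
  no-eta-equality
  constructor mkℝ
  field
    seq    : ℕ → Rational
    cauchy : Cauchy seq
open ℝ

infix 4 _≈ℝ_
record _≈ℝ_ (x y : ℝ) : Set where
  constructor mk≈
  field close : ∀ ε → 0ℚ ℚ.< ε → ∃[ N ] ∀ n → N ≤ℕ n → ℚ.∣ seq x n ℚ.- seq y n ∣ ℚ.< ε
open _≈ℝ_

module RealRing where
  open Estimates
  open ℚ using (∣_∣)

  left : ∀ {m n k} → m ⊔ n ≤ℕ k → m ≤ℕ k
  left {m} {n} = ℕP.≤-trans (ℕP.m≤m⊔n m n)

  right : ∀ {m n k} → m ⊔ n ≤ℕ k → n ≤ℕ k
  right {m} {n} = ℕP.≤-trans (ℕP.m≤n⊔m m n)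

  pointwise : ∀ {x y} → (∀ n → seq x n ≡ seq y n) → x ≈ℝ y
  pointwise {x} {y} eq = mk≈ λ ε ε> → 0 , λ n _ →
    ≡.subst (λ t → ∣ t ∣ ℚ.< ε)
      (≡.trans (≡.sym (ℚP.+-inverseʳ (seq x n))) (≡.cong (λ t → seq x n ℚ.- t) (eq n))) ε>

  ≈-isEquivalence : IsEquivalence _≈ℝ_
  ≈-isEquivalence = record
    { refl  = pointwise λ _ → ≡.refl
    ; sym   = λ {x} {y} p → mk≈ λ ε ε> → let N , q = close p ε ε> in
        N , λ n N≤n → ≡.subst (ℚ._< ε) (swap (seq x n) (seq y n)) (q n N≤n)
    ; trans = λ {x} {y} {z} p q → mk≈ λ ε ε> →
        let N , f = close p (ε ℚ.* ½) (½-pos ε>)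
            M , g = close q (ε ℚ.* ½) (½-pos ε>)
        in N ⊔ M , λ n h → triangle (seq x n) (seq y n) (seq z n) (f n (left h)) (g n (right {N} h))
    }

  infixl 6 _+_
  infixl 7 _*_
  infix  8 -_

  bounded : ∀ x → ∃[ B ] 0ℚ ℚ.< B × ∃[ N ] ∀ n → N ≤ℕ n → ∣ seq x n ∣ ℚ.< B
  bounded x =
    let N , f = cauchy x 1ℚ (ℚP.positive⁻¹ 1ℚ)
    in 1ℚ ℚ.+ ∣ seq x N ∣ , bound-pos (seq x N) , N ,
       λ n h → near-bound (seq x n) (seq x N) (f n N h ℕP.≤-refl)

  abstract
    const-cauchy : ∀ a → Cauchy (λ _ → a)
    const-cauchy a ε ε> = 0 , λ _ _ _ _ →
      ≡.subst (λ t → ∣ t ∣ ℚ.< ε) (≡.sym (ℚP.+-inverseʳ a)) ε>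

    +-cauchy : ∀ x y → Cauchy (λ n → seq x n ℚ.+ seq y n)
    +-cauchy x y ε ε> =
      let N , f = cauchy x (ε ℚ.* ½) (½-pos ε>)
          M , g = cauchy y (ε ℚ.* ½) (½-pos ε>)
      in N ⊔ M , λ m n hm hn →
           difference-+ (seq x m) (seq x n) (seq y m) (seq y n)
             (f m n (left hm) (left hn)) (g m n (right {N} hm) (right {N} hn))

    neg-cauchy : ∀ x → Cauchy (λ n → ℚ.- seq x n)
    neg-cauchy x ε ε> =
      let N , f = cauchy x ε ε>
      in N , λ m n hm hn →
           ≡.subst (ℚ._< ε) (≡.sym (difference-neg (seq x m) (seq x n))) (f m n hm hn)

    *-cauchy : ∀ x y → Cauchy (λ n → seq x n ℚ.* seq y n)
    *-cauchy x y ε ε> =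
      let B , B> , N₁ , b = bounded x
          C , C> , N₂ , c = bounded y
          δ  , δ>  , eqB = tolerance (½-pos ε>) B>
          δ′ , δ′> , eqC = tolerance (½-pos ε>) C>
          N₃ , g = cauchy y δ δ>
          N₄ , f = cauchy x δ′ δ′>
      in (N₁ ⊔ N₂) ⊔ (N₃ ⊔ N₄) , λ m n hm hn →
           difference-* (seq x m) (seq x n) (seq y m) (seq y n) B> C> eqB eqC
             (b m (left (left hm))) (c n (right {N₁} (left hn)))
             (g m n (left (right {N₁ ⊔ N₂} hm)) (left (right {N₁ ⊔ N₂} hn)))
             (f m n (right {N₃} (right {N₁ ⊔ N₂} hm)) (right {N₃} (right {N₁ ⊔ N₂} hn)))

  const : Rational → ℝ
  const a = mkℝ (λ _ → a) (const-cauchy a)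

  _+_ _*_ : ℝ → ℝ → ℝ
  x + y = mkℝ (λ n → seq x n ℚ.+ seq y n) (+-cauchy x y)
  x * y = mkℝ (λ n → seq x n ℚ.* seq y n) (*-cauchy x y)

  -_ : ℝ → ℝ
  - x = mkℝ (λ n → ℚ.- seq x n) (neg-cauchy x)

  +-cong : ∀ {x x′ y y′} → x ≈ℝ x′ → y ≈ℝ y′ → x + y ≈ℝ x′ + y′
  +-cong {x} {x′} {y} {y′} p q = mk≈ λ ε ε> →
    let N , f = close p (ε ℚ.* ½) (½-pos ε>)
        M , g = close q (ε ℚ.* ½) (½-pos ε>)
    in N ⊔ M , λ n h → difference-+ (seq x n) (seq x′ n) (seq y n) (seq y′ n)
                         (f n (left h)) (g n (right {N} h))

  -‿cong : ∀ {x y} → x ≈ℝ y → - x ≈ℝ - y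
  -‿cong {x} {y} p = mk≈ λ ε ε> → let N , f = close p ε ε> in
    N , λ n h → ≡.subst (ℚ._< ε) (≡.sym (difference-neg (seq x n) (seq y n))) (f n h)

  *-cong : ∀ {x x′ y y′} → x ≈ℝ x′ → y ≈ℝ y′ → x * y ≈ℝ x′ * y′
  *-cong {x} {x′} {y} {y′} p q = mk≈ λ ε ε> →
    let B , B> , N₁ , b = bounded x
        C , C> , N₂ , c = bounded y′
        δ  , δ>  , eqB = tolerance (½-pos ε>) B>
        δ′ , δ′> , eqC = tolerance (½-pos ε>) C>
        N₃ , g = close q δ δ>
        N₄ , f = close p δ′ δ′>
    in (N₁ ⊔ N₂) ⊔ (N₃ ⊔ N₄) , λ n h →
         difference-* (seq x n) (seq x′ n) (seq y n) (seq y′ n) B> C> eqB eqC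
           (b n (left (left h))) (c n (right {N₁} (left h)))
           (g n (left (right {N₁ ⊔ N₂} h))) (f n (right {N₃} (right {N₁ ⊔ N₂} h)))

  0ℝ 1ℝ : ℝ
  0ℝ = const 0ℚ
  1ℝ = const 1ℚ

  +-assoc : ∀ x y z → (x + y) + z ≈ℝ x + (y + z)
  +-assoc x y z = pointwise λ n → ℚP.+-assoc (seq x n) (seq y n) (seq z n)

  +-comm : ∀ x y → x + y ≈ℝ y + x
  +-comm x y = pointwise λ n → ℚP.+-comm (seq x n) (seq y n)

  +-identityˡ : ∀ x → 0ℝ + x ≈ℝ x
  +-identityˡ x = pointwise λ n → ℚP.+-identityˡ (seq x n)

  +-inverseˡ : ∀ x → - x + x ≈ℝ 0ℝ
  +-inverseˡ x = pointwise λ n → ℚP.+-inverseˡ (seq x n)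

  *-assoc : ∀ x y z → (x * y) * z ≈ℝ x * (y * z)
  *-assoc x y z = pointwise λ n → ℚP.*-assoc (seq x n) (seq y n) (seq z n)

  *-comm : ∀ x y → x * y ≈ℝ y * x
  *-comm x y = pointwise λ n → ℚP.*-comm (seq x n) (seq y n)

  *-identityˡ : ∀ x → 1ℝ * x ≈ℝ x
  *-identityˡ x = pointwise λ n → ℚP.*-identityˡ (seq x n)

  *-distribˡ-+ : ∀ x y z → x * (y + z) ≈ℝ x * y + x * z
  *-distribˡ-+ x y z = pointwise λ n → ℚP.*-distribˡ-+ (seq x n) (seq y n) (seq z n)

  ℝ-setoid : Setoid 0ℓ 0ℓ
  ℝ-setoid = record { isEquivalence = ≈-isEquivalence }

  open Consequences ℝ-setoid
    using (comm∧idˡ⇒id; comm∧invˡ⇒inv; comm∧distrˡ⇒distr)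

  isCommutativeRing : IsCommutativeRing _≈ℝ_ _+_ _*_ -_ 0ℝ 1ℝ
  isCommutativeRing = record
    { isRing = record
      { +-isAbelianGroup = record
        { isGroup = record
          { isMonoid = record
            { isSemigroup = record
              { isMagma = record { isEquivalence = ≈-isEquivalence ; ∙-cong = +-cong }
              ; assoc = +-assoc
              }
            ; identity = comm∧idˡ⇒id +-comm +-identityˡ
            }
          ; inverse = comm∧invˡ⇒inv +-comm +-inverseˡ
          ; ⁻¹-cong = -‿cong
          }
        ; comm = +-comm
        }
      ; *-cong = *-cong
      ; *-assoc = *-assoc
      ; *-identity = comm∧idˡ⇒id *-comm *-identityˡ
      ; distrib = comm∧distrˡ⇒distr +-cong *-comm *-distribˡ-+
      }
    ; *-comm = *-comm
    }

ℝ-commutativeRing : CommutativeRing 0ℓ 0ℓ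
ℝ-commutativeRing = record { isCommutativeRing = RealRing.isCommutativeRing }

module Complexification (R : CommutativeRing 0ℓ 0ℓ) where
  private module R = CommutativeRing R
  open R
    using (_+_; _*_; -_; _-_; 0#; 1#; +-cong; *-cong; -‿cong; refl; sym; trans)
    renaming (_≈_ to _≈ᴿ_)
  open import Algebra.Properties.Ring R.ring using (-0#≈0#; -1*x≈-x)
  open SemiringSolver R.commutativeSemiring using (solve; _:=_; _:+_; _:*_)

  infix 4 _≈_ _+i_
  record Complex : Set where
    constructor _+i_
    field re im : R.Carrier
  open Complex

  record _≈_ (z w : Complex) : Set where
    constructor _,_
    field
      ≈re : re z ≈ᴿ re w
      ≈im : im z ≈ᴿ im w
  open _≈_

  isCommutativeRing : IsCommutativeRing _≈_
    (λ z w → (re z + re w) +i (im z + im w))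
    (λ z w → (re z * re w - im z * im w) +i (re z * im w + im z * re w))
    (λ z → (- re z) +i (- im z)) (0# +i 0#) (1# +i 0#)
  isCommutativeRing = record
    { isRing = record
      { +-isAbelianGroup = record
        { isGroup = record
          { isMonoid = record
            { isSemigroup = record
              { isMagma = record
                { isEquivalence = record
                  { refl  = refl , refl
                  ; sym   = λ p → sym (≈re p) , sym (≈im p)
                  ; trans = λ p q → trans (≈re p) (≈re q) , trans (≈im p) (≈im q)
                  }
                ; ∙-cong = λ p q → +-cong (≈re p) (≈re q) , +-cong (≈im p) (≈im q)
                }
              ; assoc = λ x y z → R.+-assoc (re x) (re y) (re z) , R.+-assoc (im x) (im y) (im z)
              }
            ; identity = (λ x → R.+-identityˡ (re x) , R.+-identityˡ (im x))
                       , (λ x → R.+-identityʳ (re x) , R.+-identityʳ (im x))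
            }
          ; inverse = (λ x → R.-‿inverseˡ (re x) , R.-‿inverseˡ (im x))
                    , (λ x → R.-‿inverseʳ (re x) , R.-‿inverseʳ (im x))
          ; ⁻¹-cong = λ p → -‿cong (≈re p) , -‿cong (≈im p)
          }
        ; comm = λ x y → R.+-comm (re x) (re y) , R.+-comm (im x) (im y)
        }
      ; *-cong = λ p q →
          +-cong (*-cong (≈re p) (≈re q)) (-‿cong (*-cong (≈im p) (≈im q)))
        , +-cong (*-cong (≈re p) (≈im q)) (*-cong (≈im p) (≈re q))
      ; *-assoc = λ x y z →
            assoc-re (re x) (im x) (re y) (im y) (re z) (im z)
          , assoc-im (re x) (im x) (re y) (im y) (re z) (im z)
      ; *-identity =
          (λ x → one-re (re x) (im x) , one-im (re x) (im x))
        , (λ x → trans (comm-re (re x) (im x) 1# 0#) (one-re (re x) (im x))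
               , trans (comm-im (re x) (im x) 1# 0#) (one-im (re x) (im x)))
      ; distrib =
          (λ x y z → distrib-re (re x) (im x) (re y) (im y) (re z) (im z)
                   , distrib-im (re x) (im x) (re y) (im y) (re z) (im z))
        , (λ x y z →
              trans (comm-re (re y + re z) (im y + im z) (re x) (im x))
                (trans (distrib-re (re x) (im x) (re y) (im y) (re z) (im z))
                  (+-cong (comm-re (re x) (im x) (re y) (im y))
                          (comm-re (re x) (im x) (re z) (im z))))
            , trans (comm-im (re y + re z) (im y + im z) (re x) (im x))
                (trans (distrib-im (re x) (im x) (re y) (im y) (re z) (im z))
                  (+-cong (comm-im (re x) (im x) (re y) (im y))
                          (comm-im (re x) (im x) (re z) (im z)))))
      }
    ; *-comm = λ x y → comm-re (re x) (im x) (re y) (im y) , comm-im (re x) (im x) (re y) (im y)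
    }
    where
    -- The semiring solver knows no subtraction, so x - y is rewritten as x + j * y.
    j : R.Carrier
    j = - 1#

    minus : ∀ x y → x - y ≈ᴿ x + j * y
    minus x y = R.+-congˡ (sym (-1*x≈-x y))

    minus-cong : ∀ {x x′ y y′} → x ≈ᴿ x′ → y ≈ᴿ y′ → x - y ≈ᴿ x′ + j * y′
    minus-cong {x′ = x′} {y′ = y′} p q = trans (+-cong p (-‿cong q)) (minus x′ y′)

    assoc-re : ∀ a b c d e f → (a * c - b * d) * e - (a * d + b * c) * f
                             ≈ᴿ a * (c * e - d * f) - b * (c * f + d * e)
    assoc-re a b c d e f =
      trans (minus-cong (R.*-congʳ (minus (a * c) (b * d))) refl)
        (trans (eq j a b c d e f)
          (sym (minus-cong (R.*-congˡ (minus (c * e) (d * f))) refl)))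
      where
      eq : ∀ j a b c d e f → (a * c + j * (b * d)) * e + j * ((a * d + b * c) * f)
                           ≈ᴿ a * (c * e + j * (d * f)) + j * (b * (c * f + d * e))
      eq = solve 7 (λ j a b c d e f →
        (a :* c :+ j :* (b :* d)) :* e :+ j :* ((a :* d :+ b :* c) :* f)
          := a :* (c :* e :+ j :* (d :* f)) :+ j :* (b :* (c :* f :+ d :* e))) refl

    assoc-im : ∀ a b c d e f → (a * c - b * d) * f + (a * d + b * c) * e
                             ≈ᴿ a * (c * f + d * e) + b * (c * e - d * f)
    assoc-im a b c d e f =
      trans (R.+-congʳ (R.*-congʳ (minus (a * c) (b * d))))
        (trans (eq j a b c d e f)
          (sym (R.+-congˡ (R.*-congˡ (minus (c * e) (d * f))))))
      where
      eq : ∀ j a b c d e f → (a * c + j * (b * d)) * f + (a * d + b * c) * e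
                           ≈ᴿ a * (c * f + d * e) + b * (c * e + j * (d * f))
      eq = solve 7 (λ j a b c d e f →
        (a :* c :+ j :* (b :* d)) :* f :+ (a :* d :+ b :* c) :* e
          := a :* (c :* f :+ d :* e) :+ b :* (c :* e :+ j :* (d :* f))) refl

    distrib-re : ∀ a b c d e f → a * (c + e) - b * (d + f)
                               ≈ᴿ (a * c - b * d) + (a * e - b * f)
    distrib-re a b c d e f =
      trans (minus-cong refl refl)
        (trans (eq j a b c d e f) (sym (+-cong (minus (a * c) (b * d)) (minus (a * e) (b * f)))))
      where
      eq : ∀ j a b c d e f → a * (c + e) + j * (b * (d + f))
                           ≈ᴿ (a * c + j * (b * d)) + (a * e + j * (b * f))
      eq = solve 7 (λ j a b c d e f → a :* (c :+ e) :+ j :* (b :* (d :+ f))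
                      := (a :* c :+ j :* (b :* d)) :+ (a :* e :+ j :* (b :* f))) refl

    distrib-im : ∀ a b c d e f → a * (d + f) + b * (c + e)
                               ≈ᴿ (a * d + b * c) + (a * f + b * e)
    distrib-im = solve 6 (λ a b c d e f → a :* (d :+ f) :+ b :* (c :+ e)
                            := (a :* d :+ b :* c) :+ (a :* f :+ b :* e)) refl

    comm-re : ∀ a b c d → a * c - b * d ≈ᴿ c * a - d * b
    comm-re a b c d = +-cong (R.*-comm a c) (-‿cong (R.*-comm b d))

    comm-im : ∀ a b c d → a * d + b * c ≈ᴿ c * b + d * a
    comm-im a b c d = trans (+-cong (R.*-comm a d) (R.*-comm b c)) (R.+-comm (d * a) (c * b))

    one-re : ∀ a b → 1# * a - 0# * b ≈ᴿ a
    one-re a b = trans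
      (+-cong (R.*-identityˡ a) (trans (-‿cong (R.zeroˡ b)) -0#≈0#)) (R.+-identityʳ a)

    one-im : ∀ a b → 1# * b + 0# * a ≈ᴿ b
    one-im a b = trans (+-cong (R.*-identityˡ b) (R.zeroˡ a)) (R.+-identityʳ b)

  commutativeRing : CommutativeRing 0ℓ 0ℓ
  commutativeRing = record { isCommutativeRing = isCommutativeRing }

ℂ-commutativeRing : CommutativeRing 0ℓ 0ℓ
ℂ-commutativeRing = Complexification.commutativeRing ℝ-commutativeRing

open RealRing using (const)
open Complexification ℝ-commutativeRing using (_+i_) renaming (Complex to ℂ)
open CommutativeRing ℂ-commutativeRing using (_≈_; _+_; _*_; _-_; -_; 0#; 1#)
open SemiringSum (CommutativeRing.semiring ℂ-commutativeRing) using (sum)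

fromℚ : Rational → ℂ
fromℚ a = const a +i const 0ℚ

fromℤ : ℤ → ℂ
fromℤ a = fromℚ (a ℚ./ 1)

fromℕ : ℕ → ℂ
fromℕ n = fromℤ (+ n)

recip : (n : ℕ) → .{{ℕ.NonZero n}} → ℂ
recip n = fromℚ (+ 1 ℚ./ n)

∑ : ∀ {A : Set} → List A → (A → ℂ) → ℂ
∑ xs f = List.foldr _+_ 0# (List.map f xs)

PowerSeries : Set
PowerSeries = ℕ → ℂ

infix 4 _≈ₛ_
_≈ₛ_ : PowerSeries → PowerSeries → Set
f ≈ₛ g = ∀ n → f n ≈ g n

1ₛ : PowerSeries
1ₛ zero    = 1#
1ₛ (suc _) = 0#

infixl 7 _*ₛ_
_*ₛ_ : PowerSeries → PowerSeries → PowerSeries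
(f *ₛ g) n = sum {suc n} λ i → f (Fin.toℕ i) * g (n ∸ Fin.toℕ i)

infixr 8 _^ₛ_
_^ₛ_ : PowerSeries → ℕ → PowerSeries
f ^ₛ zero  = 1ₛ
f ^ₛ suc k = f *ₛ f ^ₛ k

-- ∑ₖ cₖ fᵏ for f with zero constant term, so that fᵏ does not
-- contribute to the coefficient of tⁿ when k > n.
substitute : PowerSeries → PowerSeries → PowerSeries
substitute c f n = sum {suc n} λ k → c (Fin.toℕ k) * (f ^ₛ Fin.toℕ k) n

expₛ : PowerSeries → PowerSeries
expₛ = substitute λ k → recip (k !) {{k !≢0}}

-- The inverse ∑ₖ (1 - f)ᵏ of a series f with constant term 1.
inverseₛ : PowerSeries → PowerSeries
inverseₛ f = substitute (λ _ → 1#) (λ n → 1ₛ n - f n)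

-- Integer powers of a series with constant term 1.
infixr 8 _^ℤ_
_^ℤ_ : PowerSeries → ℤ → PowerSeries
f ^ℤ (+ k)      = f ^ₛ k
f ^ℤ (-[1+ k ]) = inverseₛ f ^ₛ suc k

∏ₛ : ∀ {A : Set} → List A → (A → PowerSeries) → PowerSeries
∏ₛ xs f = List.foldr _*ₛ_ 1ₛ (List.map f xs)

1-_t : ℂ → PowerSeries
(1- c t) zero          = 1#
(1- c t) (suc zero)    = - c
(1- c t) (suc (suc _)) = 0#

Vecℂ : ℕ → Set
Vecℂ n = Fin n → ℂ

Matrix : ℕ → Set
Matrix n = Fin n → Fin n → ℂ

identity : ∀ n → Matrix n
identity n i j = if does (i Fin.≟ j) then 1# else 0#

_⊡_ : ∀ {n} → Matrix n → Matrix n → Matrix n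
(A ⊡ B) i j = sum λ k → A i k * B k j

_⊙_ : ∀ {n} → Matrix n → Vecℂ n → Vecℂ n
(A ⊙ v) i = sum λ j → A i j * v j

trace : ∀ {n} → Matrix n → ℂ
trace A = sum λ i → A i i

record Representation (G : Group 0ℓ 0ℓ) : Set where
  open Group G using (Carrier; _∙_; ε) renaming (_≈_ to _≈ᴳ_)
  field
    degree : ℕ
    ρ      : Carrier → Matrix degree
    ρ-cong : ∀ {x y} → x ≈ᴳ y → ∀ i j → ρ x i j ≈ ρ y i j
    ρ-∙    : ∀ x y → ∀ i j → ρ (x ∙ y) i j ≈ (ρ x ⊡ ρ y) i j
    ρ-ε    : ∀ i j → ρ ε i j ≈ identity degree i j

record InvariantSubspace {G : Group 0ℓ 0ℓ} (V : Representation G) : Set₁ where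
  open Representation V
  field
    _∈W    : Vecℂ degree → Set
    resp   : ∀ {v w} → (∀ i → v i ≈ w i) → v ∈W → w ∈W
    zero∈  : (λ _ → 0#) ∈W
    +-∈    : ∀ {v w} → v ∈W → w ∈W → (λ i → v i + w i) ∈W
    *-∈    : ∀ c {v} → v ∈W → (λ i → c * v i) ∈W
    stable : ∀ x {v} → v ∈W → (ρ x ⊙ v) ∈W

  IsZero IsFull : Set
  IsZero = ∀ v → v ∈W → ∀ i → v i ≈ 0#
  IsFull = ∀ v → v ∈W

record IsIrreducible {G : Group 0ℓ 0ℓ} (V : Representation G) : Set₁ where
  open InvariantSubspace
  field
    nonzero : ℕ.NonZero (Representation.degree V)
    simple  : ∀ (W : InvariantSubspace V) → ¬ (¬ IsZero W × ¬ IsFull W)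

-- An irreducible character is given by a representation affording it, and χ(1) is
-- the degree of that representation.
record IrreducibleCharacter (G : Group 0ℓ 0ℓ) : Set₁ where
  field
    representation : Representation G
    irreducible    : IsIrreducible representation
  open Representation representation public
  open Group G using (Carrier; _⁻¹)

  χ : Carrier → ℂ
  χ τ = trace (ρ τ)

  -- The character of τ ↦ ρ(τ)⁻¹.
  χ⁻¹ : Carrier → ℂ
  χ⁻¹ τ = trace (ρ (τ ⁻¹))

-- Stated as a relation because equality in ℂ is not decidable.
record IsTrivialityIndicator {A : Set} (χ : A → ℂ) (u : ℕ) : Set where
  field
    trivial    : (∀ τ → χ τ ≈ 1#) → u ≡ 1
    nontrivial : ¬ (∀ τ → χ τ ≈ 1#) → u ≡ 0

record FiniteGroup : Set₁ where
  field
    group       : Group 0ℓ 0ℓ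
    order       : ℕ
    enumeration : Inverse (Group.setoid group) (≡.setoid (Fin order))
  open Group group public
  open Inverse enumeration public
    renaming (to to index; from to element; to-cong to index-cong)
    using (strictlyInverseˡ; strictlyInverseʳ)

module _ (H : FiniteGroup) where
  open FiniteGroup H using (order; index; element; ε; _∙_; _⁻¹)

  IsSubgroup : Subset order → Set
  IsSubgroup S = index ε ∈ S
               × (∀ i j → i ∈ S → j ∈ S → index (element i ∙ element j) ∈ S)
               × (∀ i → i ∈ S → index (element i ⁻¹) ∈ S)

  isSubgroup? : ∀ S → Dec (IsSubgroup S)
  isSubgroup? S = (index ε ∈? S)
    ×-dec Fin.all? (λ i → Fin.all? λ j →
            (i ∈? S) →-dec (j ∈? S) →-dec (index (element i ∙ element j) ∈? S))
    ×-dec Fin.all? (λ i → (i ∈? S) →-dec (index (element i ⁻¹) ∈? S))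

  record Subgroup : Set where
    constructor mkSubgroup
    field
      subset     : Subset order
      isSubgroup : IsSubgroup subset

allSubsets : ∀ n → List (Subset n)
allSubsets zero    = [] ∷ []
allSubsets (suc n) =
  List.map (outside ∷_) (allSubsets n) List.++ List.map (inside ∷_) (allSubsets n)

module _ {H : FiniteGroup} where
  private module H = FiniteGroup H

  infix 4 _∈ᴴ_ _∈ᴴ?_
  _∈ᴴ_ : H.Carrier → Subgroup H → Set
  σ ∈ᴴ M = H.index σ ∈ Subgroup.subset M

  _∈ᴴ?_ : ∀ σ M → Dec (σ ∈ᴴ M)
  σ ∈ᴴ? M = H.index σ ∈? Subgroup.subset M

  ∣_∣ᴴ : Subgroup H → ℕ
  ∣ M ∣ᴴ = Subset.∣ Subgroup.subset M ∣

  ∣M∣≢0 : ∀ M → ℕ.NonZero ∣ M ∣ᴴ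
  ∣M∣≢0 M = ℕ.>-nonZero (ℕP.≤-<-trans ℕ.z≤n
              (SubsetP.x∈p⇒∣p-x∣<∣p∣ (proj₁ (Subgroup.isSubgroup M))))

  1/∣_∣ : Subgroup H → ℂ
  1/∣ M ∣ = recip ∣ M ∣ᴴ {{∣M∣≢0 M}}

  module _ (M : Subgroup H) where
    open Subgroup M

    ∙-∈ : ∀ {σ τ} → σ ∈ᴴ M → τ ∈ᴴ M → (σ H.∙ τ) ∈ᴴ M
    ∙-∈ {σ} {τ} p q = ≡.subst (_∈ subset)
      (H.index-cong (H.∙-cong (H.strictlyInverseʳ σ) (H.strictlyInverseʳ τ)))
      (proj₁ (proj₂ isSubgroup) (H.index σ) (H.index τ) p q)

    ⁻¹-∈ : ∀ {σ} → σ ∈ᴴ M → (σ H.⁻¹) ∈ᴴ M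
    ⁻¹-∈ {σ} p = ≡.subst (_∈ subset)
      (H.index-cong (H.⁻¹-cong (H.strictlyInverseʳ σ)))
      (proj₂ (proj₂ isSubgroup) (H.index σ) p)

    ⟨_⟩ : Group 0ℓ 0ℓ
    ⟨_⟩ = record
      { Carrier = ∃ (_∈ᴴ M)
      ; _≈_ = λ σ τ → proj₁ σ H.≈ proj₁ τ
      ; _∙_ = λ (σ , p) (τ , q) → (σ H.∙ τ) , ∙-∈ p q
      ; ε   = H.ε , proj₁ isSubgroup
      ; _⁻¹ = λ (σ , p) → (σ H.⁻¹) , ⁻¹-∈ p
      ; isGroup = record
        { isMonoid = record
          { isSemigroup = record
            { isMagma = record
              { isEquivalence = record { refl = H.refl ; sym = H.sym ; trans = H.trans }
              ; ∙-cong = H.∙-cong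
              }
            ; assoc = λ σ τ υ → H.assoc (proj₁ σ) (proj₁ τ) (proj₁ υ)
            }
          ; identity = (λ σ → H.identityˡ (proj₁ σ)) , (λ σ → H.identityʳ (proj₁ σ))
          }
        ; inverse = (λ σ → H.inverseˡ (proj₁ σ)) , (λ σ → H.inverseʳ (proj₁ σ))
        ; ⁻¹-cong = H.⁻¹-cong
        }
      }

    elements : List (Group.Carrier ⟨_⟩)
    elements = List.mapMaybe
      (λ i → Maybe.map (H.element i ,_) (dec⇒maybe (H.element i ∈ᴴ? M)))
      (List.allFin H.order)

subgroups : ∀ H → List (Subgroup H)
subgroups H = List.mapMaybe
  (λ S → Maybe.map (mkSubgroup S) (dec⇒maybe (isSubgroup? H S)))
  (allSubsets (FiniteGroup.order H))

-- Elements of the group algebra ℂ[H], as coefficient functions.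
ℂ[_] : FiniteGroup → Set
ℂ[ H ] = FiniteGroup.Carrier H → ℂ

idempotent : ∀ {H} (M : Subgroup H) → IrreducibleCharacter ⟨ M ⟩ → ℂ[ H ]
idempotent M χ σ with σ ∈ᴴ? M
... | yes σ∈M = fromℕ degree * 1/∣ M ∣ * χ′ ((σ , σ∈M) ⁻¹)
  where open IrreducibleCharacter χ using (degree) renaming (χ to χ′)
        open Group ⟨ M ⟩ using (_⁻¹)
... | no  _   = 0#

commutativeRing : HeytingField 0ℓ 0ℓ 0ℓ → CommutativeRing 0ℓ 0ℓ
commutativeRing K =
  HeytingCommutativeRing.commutativeRing (HeytingField.heytingCommutativeRing K)

-- The value at x of the monic polynomial Xᵈ + c_{d-1} X^{d-1} + ⋯ + c₀.
monic : (R : CommutativeRing 0ℓ 0ℓ) → let open CommutativeRing R in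
        ∀ {d} → (Fin d → Carrier) → Carrier → Carrier
monic R {d} c x = x ^ᴿ d +ᴿ sumᴿ λ i → c i *ᴿ x ^ᴿ Fin.toℕ i
  where
  open CommutativeRing R using (semiring) renaming (_+_ to _+ᴿ_; _*_ to _*ᴿ_)
  open SemiringSum semiring using () renaming (sum to sumᴿ)
  open SemiringExp semiring using () renaming (_^_ to _^ᴿ_)

record FiniteField (p q : ℕ) : Set₁ where
  field
    heytingField : HeytingField 0ℓ 0ℓ 0ℓ
  asRing : CommutativeRing 0ℓ 0ℓ
  asRing = commutativeRing heytingField
  private module R = CommutativeRing asRing
  open CommutativeRing asRing public
  open SemiringMult semiring using () renaming (_×_ to _·_)
  field
    characteristic : (p · R.1#) R.≈ R.0#
    enumeration    : Inverse setoid (≡.setoid (Fin q))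

record AlgebraicClosure {p q} (k : FiniteField p q) : Set₁ where
  private module k = FiniteField k
  field
    heytingField : HeytingField 0ℓ 0ℓ 0ℓ
  asRing : CommutativeRing 0ℓ 0ℓ
  asRing = commutativeRing heytingField
  private module R = CommutativeRing asRing
  open CommutativeRing asRing public
  open HeytingField heytingField public using (_#_)
  field
    ι       : k.Carrier → Carrier
    ι-homo  : IsRingHomomorphism k.rawRing rawRing ι
    closed  : ∀ d (c : Fin (suc d) → Carrier) → ∃[ x ] monic asRing c x R.≈ R.0#
    algebraic : ∀ x → ∃[ d ] Σ[ c ∈ (Fin d → k.Carrier) ] monic asRing (λ i → ι (c i)) x R.≈ R.0#

ContainsRootsOfUnity : ∀ {p q} {k : FiniteField p q} → AlgebraicClosure k → ℕ → Set
ContainsRootsOfUnity {k = k} k̄ n = ∀ x → x ^ᴷ n ≈ᴷ 1ᴷ → ∃[ a ] ι a ≈ᴷ x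
  where
  open AlgebraicClosure k̄ using (semiring; ι) renaming (_≈_ to _≈ᴷ_; 1# to 1ᴷ)
  open SemiringExp semiring using () renaming (_^_ to _^ᴷ_)

module Geometry {p q} {k : FiniteField p q} (k̄ : AlgebraicClosure k) where
  private
    module k = FiniteField k
    module K = AlgebraicClosure k̄
    module KP = HeytingProperties (HeytingField.heytingCommutativeRing K.heytingField)
  open AlgebraicClosure k̄ using (_#_; ι)
    renaming (Carrier to K; _≈_ to _≈ᴷ_; _*_ to _*ᴷ_; _+_ to _+ᴷ_; 0# to 0ᴷ; 1# to 1ᴷ)
  open SemiringSum K.semiring using () renaming (sum to sumᴷ)
  open MonoidSum K.*-commutativeMonoid using () renaming (sum to productᴷ)
  open SemiringMult K.semiring using () renaming (_×_ to _·_)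
  open SemiringExp K.semiring using () renaming (_^_ to _^ᴷ_)

  Coords : ℕ → Set
  Coords n = Fin (suc n) → K

  infix 4 _∼_
  _∼_ : ∀ {n} → Coords n → Coords n → Set
  x ∼ y = ∃[ c ] c # 0ᴷ × ∀ i → y i ≈ᴷ c *ᴷ x i

  ∼-isEquivalence : ∀ {n} → IsEquivalence (_∼_ {n})
  ∼-isEquivalence = record
    { refl  = 1ᴷ , KP.1#0 , λ i → K.sym (K.*-identityˡ _)
    ; sym   = ∼-sym
    ; trans = λ { (c , c# , p) (d , d# , q) → (d *ᴷ c) , KP.x#0y#0→xy#0 d# c# , λ i →
                  K.trans (q i) (K.trans (K.*-congˡ (p i)) (K.sym (K.*-assoc d c _))) }
    }
    where
    ∼-sym : ∀ {n} {x y : Coords n} → x ∼ y → y ∼ x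
    ∼-sym {x = x} {y} (c , c# , p) with HeytingField.#⇒invertible K.heytingField c#
    ... | d , dc , _ = d , KP.invertibleʳ⇒# (c , cd≈1) , λ i →
            K.sym (K.trans (K.*-congˡ (p i))
              (K.trans (K.sym (K.*-assoc d c (x i)))
                (K.trans (K.*-congʳ d*c≈1) (K.*-identityˡ (x i)))))
      where
      d*c≈1 : d *ᴷ c ≈ᴷ 1ᴷ
      d*c≈1 = K.trans (K.*-congˡ (K.sym (KP.x-0≈x c))) dc
      cd≈1 : (d K.- 0ᴷ) *ᴷ c ≈ᴷ 1ᴷ
      cd≈1 = K.trans (K.*-congʳ (KP.x-0≈x d)) d*c≈1

  -- A form of degree d in x₀, …, xₙ over k is an unnormalised list of terms.
  record Term (n d : ℕ) : Set where
    field
      coefficient : k.Carrier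
      exponent    : Fin (suc n) → ℕ
      homogeneous : ℕSum.sum exponent ≡ d

  Form : ℕ → ℕ → Set
  Form n d = List (Term n d)

  eval : ∀ {n d} → Form n d → Coords n → K
  eval f x = List.foldr _+ᴷ_ 0ᴷ (List.map term f)
    where
    term : Term _ _ → K
    term t = ι coefficient *ᴷ productᴷ λ i → x i ^ᴷ exponent i
      where open Term t

  -- The value at x of the formal partial derivative ∂f/∂xⱼ.
  partialAt : ∀ {n d} → Form n d → Coords n → Fin (suc n) → K
  partialAt f x j = List.foldr _+ᴷ_ 0ᴷ (List.map term f)
    where
    term : Term _ _ → K
    term t = exponent j · (ι coefficient *ᴷ productᴷ λ i → x i ^ᴷ lowered i)
      where
      open Term t
      lowered : Fin _ → ℕ
      lowered i = if does (i Fin.≟ j) then exponent i ∸ 1 else exponent i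

  -- Finite systems of forms, standing for their zero loci in ℙⁿ.
  Closed : ℕ → Set
  Closed n = List (∃ (Form n))

  infix 4 _∈V_
  _∈V_ : ∀ {n} → Coords n → Closed n → Set
  x ∈V Z = All (λ f → eval (proj₂ f) x ≈ᴷ 0ᴷ) Z

  record Point {n} (Y : Closed n) : Set where
    field
      coords   : Coords n
      nonzero  : ∃[ i ] coords i # 0ᴷ
      onY      : coords ∈V Y
  open Point public

  infix 4 _≈ᴾ_
  _≈ᴾ_ : ∀ {n} {Y : Closed n} → Point Y → Point Y → Set
  y ≈ᴾ z = coords y ∼ coords z

  -- The Zariski topology of Y: closed sets Y ∩ V(Z) with Z defined over k, that is,
  -- the topology of the k-scheme Y restricted to closed points.
  module _ {n} (Y : Closed n) where

    _∈ᶻ_ : Point Y → Closed n → Set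
    y ∈ᶻ Z = coords y ∈V Z

    _⊆ᶻ_ : Closed n → Closed n → Set
    Z ⊆ᶻ Z′ = ∀ y → y ∈ᶻ Z → y ∈ᶻ Z′

    NonemptyZ : Closed n → Set
    NonemptyZ Z = ∃[ y ] y ∈ᶻ Z

    IrreducibleZ : Closed n → Set
    IrreducibleZ Z = NonemptyZ Z
      × ∀ A B → (∀ y → y ∈ᶻ Z → y ∈ᶻ A ⊎ y ∈ᶻ B) → Z ⊆ᶻ A ⊎ Z ⊆ᶻ B

    Chain : ℕ → Set
    Chain m = Σ[ Z ∈ (Fin (suc m) → Closed n) ] (∀ i → IrreducibleZ (Z i))
      × (∀ (i : Fin m) → Z (Fin.inject₁ i) ⊆ᶻ Z (suc i) × ¬ (Z (suc i) ⊆ᶻ Z (Fin.inject₁ i)))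

    HasDimension : ℕ → Set
    HasDimension m = Chain m × ¬ Chain (suc m)

    Connected : Set
    Connected = Point Y × (∀ A B → NonemptyZ A → NonemptyZ B →
      (∀ y → y ∈ᶻ A ⊎ y ∈ᶻ B) → ¬ (∀ y → ¬ (y ∈ᶻ A × y ∈ᶻ B)))

  -- The kernel of the Jacobian matrix at y of the equations of Y.
  Tangent : ∀ {n} (Y : Closed n) → Point Y → Coords n → Set
  Tangent Y y v = All (λ f → sumᴷ (λ j → partialAt (proj₂ f) (coords y) j *ᴷ v j) ≈ᴷ 0ᴷ) Y

  record HasBasis {n} (W : Coords n → Set) (r : ℕ) : Set where
    field
      basis       : Fin r → Coords n
      basis∈      : ∀ a → W (basis a)
      independent : ∀ (c : Fin r → K) →
                    (∀ i → sumᴷ (λ a → c a *ᴷ basis a i) ≈ᴷ 0ᴷ) → ∀ a → c a ≈ᴷ 0ᴷ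
      spanning    : ∀ v → W v → Σ[ c ∈ (Fin r → K) ] ∀ i → v i ≈ᴷ sumᴷ (λ a → c a *ᴷ basis a i)

  -- The Jacobian criterion: at every point the Jacobian matrix, which has n + 1
  -- columns, has rank n - m, so its kernel has dimension m + 1.
  SmoothOfDimension : ∀ {n} → ℕ → Closed n → Set
  SmoothOfDimension m Y = HasDimension Y m × ∀ y → HasBasis (Tangent Y y) (suc m)

  record Curve : Set where
    field
      ambient   : ℕ
      equations : Closed ambient
      smooth    : SmoothOfDimension 1 equations
      connected : Connected equations
    CurvePoint : Set
    CurvePoint = Point equations

  -- Y → Y is a k-morphism: locally (on a Zariski neighbourhood of each point)
  -- it is given by forms over k of equal degree.
  IsMorphism : (Y : Curve) → let open Curve Y in (CurvePoint → CurvePoint) → Set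
  IsMorphism Y φ = ∀ (y : CurvePoint) → ∃[ d ] Σ[ g ∈ (Fin (suc ambient) → Form ambient d) ]
      (∃[ i ] eval (g i) (coords y) # 0ᴷ)
    × (∀ (z : CurvePoint) i → eval (g i) (coords z) # 0ᴷ → coords (φ z) ∼ (λ j → eval (g j) (coords z)))
    where open Curve Y

  record FaithfulAction (H : FiniteGroup) (Y : Curve) : Set where
    private module H = FiniteGroup H
    open Curve Y
    infixr 8 _▹_
    field
      _▹_      : H.Carrier → CurvePoint → CurvePoint
      ▹-cong   : ∀ {σ τ y z} → σ H.≈ τ → y ≈ᴾ z → σ ▹ y ≈ᴾ τ ▹ z
      ▹-ε      : ∀ y → H.ε ▹ y ≈ᴾ y
      ▹-∙      : ∀ σ τ y → (σ H.∙ τ) ▹ y ≈ᴾ σ ▹ τ ▹ y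
      morphism : ∀ σ → IsMorphism Y (σ ▹_)
      faithful : ∀ σ → (∀ y → σ ▹ y ≈ᴾ y) → σ H.≈ H.ε

  frobenius : ∀ {n} → ℕ → Coords n → Coords n
  frobenius ν x i = x i ^ᴷ (q ℕ.^ ν)

  module _ {H : FiniteGroup} {Y : Curve} (action : FaithfulAction H Y) where
    private module H = FiniteGroup H
    open Curve Y
    open FaithfulAction action

    -- F is given by its graph: z is the point F^ν(y), which always lies on Y
    -- since the equations of Y have coefficients in k.
    record FixedPoint (τ : H.Carrier) (ν : ℕ) : Set where
      field
        y z   : CurvePoint
        z∼F^νy : coords z ∼ frobenius ν (coords y)
        fixed : τ ▹ z ≈ᴾ y

    FixedPoints : H.Carrier → ℕ → Setoid 0ℓ 0ℓ
    FixedPoints τ ν = record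
      { Carrier = FixedPoint τ ν
      ; _≈_ = λ a b → FixedPoint.y a ≈ᴾ FixedPoint.y b
      ; isEquivalence = record
        { refl  = IsEquivalence.refl ∼-isEquivalence
        ; sym   = IsEquivalence.sym ∼-isEquivalence
        ; trans = IsEquivalence.trans ∼-isEquivalence
        }
      }

    CountsFixedPoints : (H.Carrier → ℕ → ℕ) → Set
    CountsFixedPoints Λ = ∀ τ ν → 1 ≤ℕ ν → Inverse (FixedPoints τ ν) (≡.setoid (Fin (Λ τ ν)))

open Geometry public
  using (Curve; FaithfulAction; CountsFixedPoints)

-- The Artin L-function of Y → Y/M depends on Y only through the numbers Λ τ ν
-- of fixed points of τ ∘ F^ν on Y.
module _ {H : FiniteGroup} (Λ : FiniteGroup.Carrier H → ℕ → ℕ) (M : Subgroup H)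
         (χ : Group.Carrier ⟨ M ⟩ → ℂ) where
  open Group ⟨ M ⟩ using (_⁻¹)

  A : ℕ → ℂ
  A ν = 1/∣ M ∣ * ∑ (elements M) λ τ → χ (τ ⁻¹) * fromℕ (Λ (proj₁ τ) ν)

  logL : PowerSeries
  logL zero      = 0#
  logL ν@(suc _) = A ν * recip ν

  L : PowerSeries
  L = expₛ logL

  -- The solution of L = P / ((1 - qt)^u (1 - t)^u), where u is the triviality
  -- indicator of χ.  Its constant term is 1, so _^ℤ_ applies to it.  That it is a
  -- polynomial (for geometrically connected Y) is a theorem of Weil, not part of the
  -- definition.
  P : ℕ → ℕ → PowerSeries
  P q u = L *ₛ ((1- fromℕ q t) ^ₛ u *ₛ (1- 1# t) ^ₛ u)

module Submission where

-- Pairing τ ↦ ∑ s_M e_{χ_M}(τ⁻¹) = 0 with a function φ on H gives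
-- ∑_M χ_M(1) s_M a_M(φ) = 0, where a_M(φ) = 1/|M| ∑_{τ∈M} χ_M(τ) φ(τ).  For
-- φ(τ) = Λ(τ ∘ F^ν) this is a relation between the coefficients A_ν of the log L; for
-- φ = 1 it is a relation between the exponents u of the factors (1 - qt)(1 - t), since
-- by Schur's lemma a_M(1) is the multiplicity of the trivial character.  Hence the
-- logarithmic derivative t d/dt log of the product vanishes, and the product, having
-- constant term 1, is 1.

open import Defs
open import Level using (0ℓ)
open import Algebra.Bundles using (CommutativeRing; CommutativeSemiring; Group)
import Algebra.Consequences.Setoid as Consequences
import Algebra.Properties.CommutativeMonoid.Mult as MonoidMult
import Algebra.Properties.CommutativeSemigroup as CommutativeSemigroupProperties
import Algebra.Properties.Group as GroupProperties
import Algebra.Properties.Ring as RingProperties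
import Algebra.Properties.Semiring.Mult as SemiringMult
import Algebra.Properties.Semiring.Sum as SemiringSum
import Algebra.Solver.Ring.NaturalCoefficients.Default as SemiringSolver
open import Data.Fin.Base as Fin using (Fin; zero; suc)
import Data.Fin.Properties as FinP
open import Data.Fin.Permutation using (Permutation′; permutation)
open import Data.Fin.Subset using (Subset; inside; outside; _∈_; _∉_; ∣_∣)
open import Data.Fin.Subset.Properties using (drop-there)
open import Data.Integer.Base as ℤ using (ℤ; +_; -[1+_])
import Data.Integer.Properties as ℤP
open import Data.List.Base as List using (List; []; _∷_)
open import Data.Maybe.Base as Maybe using (Maybe; just; nothing; maybe′)
open import Data.Nat.Base as ℕ using (ℕ; zero; suc; _∸_; z≤n; s≤s; _!)
import Data.Nat.Coprimality as Coprimality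
open Coprimality using (Coprime)
open import Data.Nat.Primality using (Prime)
import Data.Nat.Properties as ℕP
open import Data.Nat.Properties using (_!≢0)
open import Data.Product.Base using (_,_; proj₁)
import Data.Rational.Base as ℚ
import Data.Rational.Properties as ℚP
open import Data.Rational.Unnormalised.Base as ℚᵘ using (mkℚᵘ; *≡*)
import Data.Rational.Unnormalised.Properties as ℚᵘP
open import Data.Vec.Base using ([]; _∷_; here; there)
open import Function.Base using (_∘_)
open import Relation.Binary.Bundles using (Setoid)
open import Relation.Binary.PropositionalEquality.Core as ≡ using (_≡_)
import Relation.Binary.Reasoning.Setoid as SetoidReasoning
open import Relation.Nullary.Decidable using (yes; no; dec⇒maybe; decidable-stable)
open import Relation.Nullary.Negation using (¬_; contradiction)

-- The logarithmic derivative is used as the division-free equation `θ f = g f`: it is additive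
-- under products, covers negative exponents, and over a torsion-free ring g = 0 forces f = 1 once
-- the constant term is 1. Each coefficient of an idempotent carries χ_M(1), which is the origin of
-- this factor in the exponents; the coefficient is read at τ⁻¹ because it stores χ(σ⁻¹), while
-- A_ν(χ⁻¹) averages χ(τ). Since 1 - qt and 1 - t occur with the same exponent u, one integer
-- relation removes both. The obstacle is constructive. Equality in ℂ is undecidable and
-- irreducibility only excludes a subspace that is neither zero nor full, so Schur's lemma gives
-- a_M(1) = u_M under a double negation. The sum of the χ_M(1) s_M u_M is an integer, however, and
-- equality in ℤ is decidable, so the double negation can be removed there.

-- Formal power series over a commutative ring.

module FormalSeries (R : CommutativeRing 0ℓ 0ℓ) where
  open CommutativeRing R hiding (zero)
  open RingProperties ring using (-‿distribˡ-*; +-cancelʳ)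
  open SemiringSum semiring using (sum; sum-cong-≋; sum-replicate-zero)
  open SemiringMult semiring using (×-congʳ; ×-comm-*; ×-assoc-*) renaming (_×_ to _·_)
  open MonoidMult +-commutativeMonoid using (×-distrib-+)
  open SemiringSolver commutativeSemiring using (solve; _:=_; _:+_; _:*_; con)
  open SetoidReasoning setoid

  Series : Set
  Series = ℕ → Carrier

  infix 4 _≋_
  _≋_ : Series → Series → Set
  f ≋ g = ∀ n → f n ≈ g n

  0ₚ 1ₚ : Series
  0ₚ _ = 0#
  1ₚ zero    = 1#
  1ₚ (suc _) = 0#

  infixl 6 _⊕_
  infixl 7 _⊛_
  _⊕_ _⊛_ : Series → Series → Series
  (f ⊕ g) n = f n + g n
  (f ⊛ g) n = sum {suc n} λ i → f (Fin.toℕ i) * g (n ∸ Fin.toℕ i)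

  tail : Series → Series
  tail f n = f (suc n)

  ⊛-zero : ∀ f g → (f ⊛ g) 0 ≈ f 0 * g 0
  ⊛-zero f g = +-identityʳ _

  -- f ⊛ g satisfies (f ⊛ g) (suc n) = f 0 * g (suc n) + (tail f ⊛ g) n by
  -- computation; the ring laws follow from it by induction on the coefficient.
  ⊛-cong-≤ : ∀ {f f′ g g′} n → (∀ i → i ℕ.≤ n → f i ≈ f′ i) → (∀ i → i ℕ.≤ n → g i ≈ g′ i) →
             (f ⊛ g) n ≈ (f′ ⊛ g′) n
  ⊛-cong-≤ zero p q = +-congʳ (*-cong (p 0 z≤n) (q 0 z≤n))
  ⊛-cong-≤ (suc n) p q = +-cong (*-cong (p 0 z≤n) (q (suc n) ℕP.≤-refl))
    (⊛-cong-≤ n (λ i i≤n → p (suc i) (s≤s i≤n)) (λ i i≤n → q i (ℕP.m≤n⇒m≤1+n i≤n)))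

  ⊛-cong : ∀ {f f′ g g′} → f ≋ f′ → g ≋ g′ → f ⊛ g ≋ f′ ⊛ g′
  ⊛-cong p q n = ⊛-cong-≤ n (λ i _ → p i) (λ i _ → q i)

  ⊛-zeroˡ : ∀ g → 0ₚ ⊛ g ≋ 0ₚ
  ⊛-zeroˡ g zero    = trans (⊛-zero 0ₚ g) (zeroˡ _)
  ⊛-zeroˡ g (suc n) = trans (+-cong (zeroˡ _) (⊛-zeroˡ g n)) (+-identityˡ _)

  ⊛-distribʳ : ∀ h f g → (f ⊕ g) ⊛ h ≋ f ⊛ h ⊕ g ⊛ h
  ⊛-distribʳ h f g zero =
    solve 3 (λ a b c → (a :+ b) :* c :+ con 0 := (a :* c :+ con 0) :+ (b :* c :+ con 0))
      refl (f 0) (g 0) (h 0)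
  ⊛-distribʳ h f g (suc n) = trans (+-congˡ (⊛-distribʳ h (tail f) (tail g) n))
    (solve 5 (λ a b c d e → (a :+ b) :* c :+ (d :+ e) := (a :* c :+ d) :+ (b :* c :+ e))
      refl (f 0) (g 0) (h (suc n)) ((tail f ⊛ h) n) ((tail g ⊛ h) n))

  ⊛-scaleˡ : ∀ a f g n → ((λ i → a * f i) ⊛ g) n ≈ a * (f ⊛ g) n
  ⊛-scaleˡ a f g zero =
    solve 3 (λ a b c → (a :* b) :* c :+ con 0 := a :* (b :* c :+ con 0)) refl a (f 0) (g 0)
  ⊛-scaleˡ a f g (suc n) = trans (+-congˡ (⊛-scaleˡ a (tail f) g n))
    (solve 4 (λ a b c d → (a :* b) :* c :+ a :* d := a :* (b :* c :+ d))
      refl a (f 0) (g (suc n)) ((tail f ⊛ g) n))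

  -- The mirror image of the computational recursion, splitting off the last term instead of the
  -- first; commutativity exchanges the two.
  ⊛-suc′ : ∀ f g n → (f ⊛ g) (suc n) ≈ (f ⊛ tail g) n + f (suc n) * g 0
  ⊛-suc′ f g zero =
    solve 2 (λ a b → a :+ (b :+ con 0) := (a :+ con 0) :+ b) refl (f 0 * g 1) (f 1 * g 0)
  ⊛-suc′ f g (suc n) =
    trans (+-congˡ (⊛-suc′ (tail f) g n)) (sym (+-assoc _ _ _))

  ⊛-comm : ∀ f g → f ⊛ g ≋ g ⊛ f
  ⊛-comm f g zero = +-congʳ (*-comm (f 0) (g 0))
  ⊛-comm f g (suc n) = begin
    f 0 * g (suc n) + (tail f ⊛ g) n   ≈⟨ +-cong (*-comm _ _) (⊛-comm (tail f) g n) ⟩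
    g (suc n) * f 0 + (g ⊛ tail f) n   ≈⟨ +-comm _ _ ⟩
    (g ⊛ tail f) n + g (suc n) * f 0   ≈⟨ ⊛-suc′ g f n ⟨
    (g ⊛ f) (suc n)                    ∎

  ⊛-assoc : ∀ f g h → (f ⊛ g) ⊛ h ≋ f ⊛ (g ⊛ h)
  ⊛-assoc f g h zero =
    solve 3 (λ a b c → (a :* b :+ con 0) :* c :+ con 0 := a :* (b :* c :+ con 0) :+ con 0)
      refl (f 0) (g 0) (h 0)
  ⊛-assoc f g h (suc n) = begin
    (f ⊛ g) 0 * h (suc n) + (tail (f ⊛ g) ⊛ h) n
      -- By computation `tail (f ⊛ g)` is the sum of `f 0` times `tail g` and `tail f ⊛ g`.
      ≈⟨ +-cong (*-congʳ (⊛-zero f g)) (⊛-distribʳ h (λ i → f 0 * g (suc i)) (tail f ⊛ g) n) ⟩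
    f 0 * g 0 * h (suc n) + (((λ i → f 0 * g (suc i)) ⊛ h) n + ((tail f ⊛ g) ⊛ h) n)
      ≈⟨ +-congˡ (+-cong (⊛-scaleˡ (f 0) (tail g) h n) (⊛-assoc (tail f) g h n)) ⟩
    f 0 * g 0 * h (suc n) + (f 0 * (tail g ⊛ h) n + (tail f ⊛ (g ⊛ h)) n)
      ≈⟨ solve 5 (λ a b c d e → a :* b :* c :+ (a :* d :+ e) := a :* (b :* c :+ d) :+ e)
           refl (f 0) (g 0) (h (suc n)) ((tail g ⊛ h) n) ((tail f ⊛ (g ⊛ h)) n) ⟩
    f 0 * (g 0 * h (suc n) + (tail g ⊛ h) n) + (tail f ⊛ (g ⊛ h)) n ∎

  ⊛-identityˡ : ∀ f → 1ₚ ⊛ f ≋ f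
  ⊛-identityˡ f zero    = trans (⊛-zero 1ₚ f) (*-identityˡ _)
  ⊛-identityˡ f (suc n) =
    trans (+-cong (*-identityˡ _) (⊛-zeroˡ f n)) (+-identityʳ _)

  seriesSetoid : Setoid 0ℓ 0ℓ
  seriesSetoid = record
    { Carrier = Series
    ; _≈_ = _≋_
    ; isEquivalence = record
      { refl  = λ _ → refl
      ; sym   = λ p n → sym (p n)
      ; trans = λ p q n → trans (p n) (q n)
      }
    }

  private module C = Consequences seriesSetoid

  ⊕-cong : ∀ {f f′ g g′} → f ≋ f′ → g ≋ g′ → f ⊕ g ≋ f′ ⊕ g′
  ⊕-cong p q n = +-cong (p n) (q n)

  seriesSemiring : CommutativeSemiring 0ℓ 0ℓ
  seriesSemiring = record
    { Carrier = Series
    ; _≈_ = _≋_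
    ; _+_ = _⊕_
    ; _*_ = _⊛_
    ; 0# = 0ₚ
    ; 1# = 1ₚ
    ; isCommutativeSemiring = record
      { isSemiring = record
        { isSemiringWithoutAnnihilatingZero = record
          { +-isCommutativeMonoid = record
            { isMonoid = record
              { isSemigroup = record
                { isMagma = record
                  { isEquivalence = Setoid.isEquivalence seriesSetoid
                  ; ∙-cong = ⊕-cong
                  }
                ; assoc = λ f g h n → +-assoc (f n) (g n) (h n)
                }
              ; identity = (λ f n → +-identityˡ (f n)) , (λ f n → +-identityʳ (f n))
              }
            ; comm = λ f g n → +-comm (f n) (g n)
            }
          ; *-cong = ⊛-cong
          ; *-assoc = ⊛-assoc
          ; *-identity = C.comm∧idˡ⇒id ⊛-comm ⊛-identityˡ
          ; distrib = C.comm∧distrʳ⇒distr ⊕-cong ⊛-comm ⊛-distribʳ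
          }
        ; zero = C.comm∧zeˡ⇒ze ⊛-comm ⊛-zeroˡ
        }
      ; *-comm = ⊛-comm
      }
    }

  private
    module S = CommutativeSemiring seriesSemiring
    module SS = SemiringSolver seriesSemiring
    module ≋-Reasoning = SetoidReasoning seriesSetoid

  ·-zeroʳ : ∀ n → n · 0# ≈ 0#
  ·-zeroʳ zero    = refl
  ·-zeroʳ (suc n) = trans (+-identityˡ _) (·-zeroʳ n)

  -- The Euler operator t d/dt.
  θ : Series → Series
  θ f n = n · f n

  θ-cong : ∀ {f g} → f ≋ g → θ f ≋ θ g
  θ-cong p n = ×-congʳ n (p n)

  θ-1 : θ 1ₚ ≋ 0ₚ
  θ-1 zero    = refl
  θ-1 (suc n) = ·-zeroʳ (suc n)

  -- Leibniz rule by induction along `tail`: since `suc n · x` unfolds to `x + n · x`, `tail (θ f)`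
  -- is `tail f ⊕ θ (tail f)` by computation.
  θ-⊛ : ∀ f g → θ (f ⊛ g) ≋ θ f ⊛ g ⊕ f ⊛ θ g
  θ-⊛ f g zero = sym (trans (+-cong (trans (+-identityʳ _) (zeroˡ _))
                                    (trans (+-identityʳ _) (zeroʳ _))) (+-identityʳ _))
  θ-⊛ f g (suc n) = begin
    suc n · (f 0 * g (suc n) + (tail f ⊛ g) n)
      ≈⟨ ×-distrib-+ _ _ (suc n) ⟩
    suc n · (f 0 * g (suc n)) + ((tail f ⊛ g) n + θ (tail f ⊛ g) n)
      ≈⟨ +-cong (sym (×-comm-* (suc n) _ _)) (+-congˡ (θ-⊛ (tail f) g n)) ⟩
    f 0 * θ g (suc n) + ((tail f ⊛ g) n + ((θ (tail f) ⊛ g) n + (tail f ⊛ θ g) n))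
      -- The added `con 0 :* x` is the leading term of `θ f ⊛ g`, as `θ f 0` computes to `0#`.
      ≈⟨ solve 5 (λ a b c d x → a :+ (b :+ (c :+ d)) := (con 0 :* x :+ (b :+ c)) :+ (a :+ d))
           refl _ _ _ _ (g (suc n)) ⟩
    (0# * g (suc n) + ((tail f ⊛ g) n + (θ (tail f) ⊛ g) n))
      + (f 0 * θ g (suc n) + (tail f ⊛ θ g) n)
      ≈⟨ +-congʳ (+-congˡ (⊛-distribʳ g (tail f) (θ (tail f)) n)) ⟨
    (θ f ⊛ g ⊕ f ⊛ θ g) (suc n) ∎

  infixr 8 _^ₚ_
  _^ₚ_ : Series → ℕ → Series
  f ^ₚ zero  = 1ₚ
  f ^ₚ suc k = f ⊛ f ^ₚ k

  θ-^ : ∀ f k → θ (f ^ₚ suc k) ≋ λ n → suc k · (θ f ⊛ f ^ₚ k) n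
  θ-^ f zero = S.trans (θ-cong (S.*-identityʳ f))
    (S.trans (S.sym (S.*-identityʳ (θ f))) (λ n → sym (+-identityʳ _)))
  θ-^ f (suc k) n = begin
    θ (f ⊛ f ^ₚ suc k) n
      ≈⟨ θ-⊛ f (f ^ₚ suc k) n ⟩
    (θ f ⊛ f ^ₚ suc k) n + (f ⊛ θ (f ^ₚ suc k)) n
      ≈⟨ +-congˡ (⊛-cong {f = f} S.refl (θ-^ f k) n) ⟩
    (θ f ⊛ f ^ₚ suc k) n + (f ⊛ (λ i → suc k · (θ f ⊛ f ^ₚ k) i)) n
      ≈⟨ +-congˡ (⊛-· (suc k) f (θ f ⊛ f ^ₚ k) n) ⟩
    (θ f ⊛ f ^ₚ suc k) n + suc k · (f ⊛ (θ f ⊛ f ^ₚ k)) n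
      ≈⟨ +-congˡ (×-congʳ (suc k)
           (SS.solve 3 (λ a b c → a SS.:* (b SS.:* c) SS.:= b SS.:* (a SS.:* c)) S.refl f (θ f) (f ^ₚ k) n)) ⟩
    suc (suc k) · (θ f ⊛ f ^ₚ suc k) n ∎
    where
    ⊛-· : ∀ m f g n → (f ⊛ (λ i → m · g i)) n ≈ m · (f ⊛ g) n
    ⊛-· zero    f g = S.zeroʳ f
    ⊛-· (suc m) f g n = trans (S.distribˡ f g (λ i → m · g i) n) (+-congˡ (⊛-· m f g n))

  -- Substitution into a power series and inverses.

  Σ< : ℕ → (ℕ → Carrier) → Carrier
  Σ< N a = sum {N} λ k → a (Fin.toℕ k)

  Σ<-cong : ∀ N {a b : ℕ → Carrier} → (∀ k → a k ≈ b k) → Σ< N a ≈ Σ< N b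
  Σ<-cong N p = sum-cong-≋ {N} λ k → p (Fin.toℕ k)

  Σ<-zero : ∀ N {a : ℕ → Carrier} → (∀ k → a k ≈ 0#) → Σ< N a ≈ 0#
  Σ<-zero N p = trans (Σ<-cong N p) (sum-replicate-zero N)

  Σ<-truncate : ∀ {n N} (a : ℕ → Carrier) → n ℕ.≤ N → (∀ k → n ℕ.≤ k → a k ≈ 0#) → Σ< n a ≈ Σ< N a
  Σ<-truncate {N = N} a z≤n p = sym (Σ<-zero N λ k → p k z≤n)
  Σ<-truncate a (s≤s n≤N) p = +-congˡ (Σ<-truncate (a ∘ suc) n≤N λ k n≤k → p (suc k) (s≤s n≤k))

  substituteₚ : Series → Series → Series
  substituteₚ c f n = Σ< (suc n) λ k → c k * (f ^ₚ k) n

  -- A series with zero constant term is divisible by t, hence its k-th power by t^k.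
  ^-vanishes : ∀ {f} → f 0 ≈ 0# → ∀ {n k} → n ℕ.< k → (f ^ₚ k) n ≈ 0#
  ^-vanishes {f} f0 {zero} {suc k} _ =
    trans (⊛-zero f (f ^ₚ k)) (trans (*-congʳ f0) (zeroˡ _))
  ^-vanishes {f} f0 {suc n} {suc k} (s≤s n<k) = trans (+-cong (trans (*-congʳ f0) (zeroˡ _))
      (trans (⊛-cong-≤ {f = tail f} n (λ _ _ → refl)
                (λ i i≤n → ^-vanishes {f} f0 {k = k} (ℕP.≤-<-trans i≤n n<k)))
             (S.zeroʳ (tail f) n)))
    (+-identityˡ _)

  -- The defining sum has a bound that grows with the coefficient. A bound common to all
  -- coefficients up to n lets a product be distributed over it.
  substitute-truncate : ∀ c f → f 0 ≈ 0# → ∀ {n N} → n ℕ.< N →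
                        substituteₚ c f n ≈ Σ< N λ k → c k * (f ^ₚ k) n
  substitute-truncate c f f0 {n} n<N = Σ<-truncate (λ k → c k * (f ^ₚ k) n) n<N λ k n<k →
    trans (*-congˡ (^-vanishes {f} f0 n<k)) (zeroʳ (c k))

  ⊛-substitute : ∀ c g f → f 0 ≈ 0# → ∀ n →
                 (g ⊛ substituteₚ c f) n ≈ Σ< (suc n) λ k → c k * (g ⊛ f ^ₚ k) n
  ⊛-substitute c g f f0 n = trans
    (⊛-cong-≤ {f = g} n (λ _ _ → refl) λ i i≤n → substitute-truncate c f f0 (s≤s i≤n))
    (go (suc n) c (f ^ₚ_))
    where
    go : ∀ N (c : ℕ → Carrier) (h : ℕ → Series) →
         (g ⊛ λ i → Σ< N λ k → c k * h k i) n ≈ Σ< N λ k → c k * (g ⊛ h k) n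
    go zero    c h = S.zeroʳ g n
    go (suc N) c h = trans
      (S.distribˡ g (λ i → c 0 * h 0 i) (λ i → Σ< N λ k → c (suc k) * h (suc k) i) n)
      (+-cong (trans (⊛-comm g (λ i → c 0 * h 0 i) n) (trans (⊛-scaleˡ (c 0) (h 0) g n) (*-congˡ (⊛-comm (h 0) g n))))
              (go N (c ∘ suc) (h ∘ suc)))

  substitute-0 : ∀ c f → substituteₚ c f 0 ≈ c 0
  substitute-0 c f = trans (+-identityʳ _) (*-identityʳ _)

  invₚ : Series → Series
  invₚ f = substituteₚ (λ _ → 1#) λ n → 1ₚ n - f n

  -- With h = 1 - f, the geometric series i satisfies both (f + h) i = i and i = 1 + h i; cancel h
  -- i.
  inv-inverse : ∀ {f} → f 0 ≈ 1# → f ⊛ invₚ f ≋ 1ₚ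
  inv-inverse {f} f0 n = +-cancelʳ ((h ⊛ invₚ f) n) _ _ (begin
    (f ⊛ invₚ f) n + (h ⊛ invₚ f) n  ≈⟨ ⊛-distribʳ (invₚ f) f h n ⟨
    ((f ⊕ h) ⊛ invₚ f) n             ≈⟨ ⊛-cong {g = invₚ f} f+h S.refl n ⟩
    (1ₚ ⊛ invₚ f) n                  ≈⟨ ⊛-identityˡ (invₚ f) n ⟩
    -- The bound is n + 2, one more than necessary, so that n + 1 terms remain once k = 0 is split
    -- off.
    invₚ f n                         ≈⟨ substitute-truncate (λ _ → 1#) h h0 {n} (ℕP.m<n⇒m<1+n ℕP.≤-refl) ⟩
    1# * 1ₚ n + Σ< (suc n) (λ k → 1# * (h ^ₚ suc k) n)
      ≈⟨ +-cong (*-identityˡ _) (sym (⊛-substitute (λ _ → 1#) h h h0 n)) ⟩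
    1ₚ n + (h ⊛ invₚ f) n            ∎)
    where
    h : Series
    h n = 1ₚ n - f n
    h0 : h 0 ≈ 0#
    h0 = trans (+-congˡ (-‿cong f0)) (-‿inverseʳ 1#)
    f+h : f ⊕ h ≋ 1ₚ
    f+h n = trans (+-comm _ _) (trans (+-assoc _ _ _) (trans (+-congˡ (-‿inverseˡ _)) (+-identityʳ _)))

  -- Logarithmic derivatives.

  infix 4 _HasLogDerivative_
  record _HasLogDerivative_ (f g : Series) : Set where
    field
      constant   : f 0 ≈ 1#
      derivative : θ f ≋ g ⊛ f
  open _HasLogDerivative_ public

  log-cong : ∀ {f g h} → g ≋ h → f HasLogDerivative g → f HasLogDerivative h
  log-cong g≋h p = record
    { constant   = constant p
    ; derivative = S.trans (derivative p) (⊛-cong g≋h S.refl)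
    }

  log-resp : ∀ {f f′ g} → f ≋ f′ → f HasLogDerivative g → f′ HasLogDerivative g
  log-resp {g = g} f≋f′ p = record
    { constant   = trans (sym (f≋f′ 0)) (constant p)
    ; derivative = S.trans (θ-cong (S.sym f≋f′)) (S.trans (derivative p) (⊛-cong {f = g} S.refl f≋f′))
    }

  log-1 : 1ₚ HasLogDerivative 0ₚ
  log-1 = record { constant = refl ; derivative = S.trans θ-1 (S.sym (⊛-zeroˡ 1ₚ)) }

  log-⊛ : ∀ {f f′ g g′} → f HasLogDerivative g → f′ HasLogDerivative g′ →
          f ⊛ f′ HasLogDerivative g ⊕ g′
  log-⊛ {f} {f′} {g} {g′} p p′ = record
    { constant   = trans (⊛-zero f f′) (trans (*-cong (constant p) (constant p′)) (*-identityˡ 1#))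
    ; derivative = ≋.begin
        θ (f ⊛ f′)                  ≋.≈⟨ θ-⊛ f f′ ⟩
        θ f ⊛ f′ ⊕ f ⊛ θ f′         ≋.≈⟨ ⊕-cong (⊛-cong {g = f′} (derivative p) S.refl)
                                             (⊛-cong {f = f} S.refl (derivative p′)) ⟩
        g ⊛ f ⊛ f′ ⊕ f ⊛ (g′ ⊛ f′)  ≋.≈⟨ SS.solve 4 (λ f f′ g g′ → g SS.:* f SS.:* f′ SS.:+ f SS.:* (g′ SS.:* f′)
                                          SS.:= (g SS.:+ g′) SS.:* (f SS.:* f′)) S.refl f f′ g g′ ⟩
        (g ⊕ g′) ⊛ (f ⊛ f′)         ≋.∎
    }
    where module ≋ = ≋-Reasoning

  ⊛-negˡ : ∀ f g → (λ i → - f i) ⊛ g ≋ λ i → - (f ⊛ g) i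
  ⊛-negˡ f g n = trans (⊛-cong {g = g} (λ i → trans (-‿cong (sym (*-identityˡ _))) (-‿distribˡ-* 1# (f i))) S.refl n)
    (trans (⊛-scaleˡ (- 1#) f g n) (trans (sym (-‿distribˡ-* 1# _)) (-‿cong (*-identityˡ _))))

  -- Differentiating f i = 1 gives f θi = - θf i = - g f i = - g; multiplying by i gives θi = - g i.
  log-inv : ∀ {f g} → f HasLogDerivative g → invₚ f HasLogDerivative λ n → - g n
  log-inv {f} {g} p = record
    { constant   = substitute-0 (λ _ → 1#) (λ n → 1ₚ n - f n)
    ; derivative = ≋.begin
        θ i                       ≋.≈⟨ S.*-identityʳ (θ i) ⟨
        θ i ⊛ 1ₚ                  ≋.≈⟨ ⊛-cong {f = θ i} S.refl fi≋1 ⟨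
        θ i ⊛ (f ⊛ i)             ≋.≈⟨ SS.solve 3 (λ a b c → a SS.:* (b SS.:* c) SS.:= (b SS.:* a) SS.:* c) S.refl (θ i) f i ⟩
        (f ⊛ θ i) ⊛ i             ≋.≈⟨ ⊛-cong {g = i} fθi S.refl ⟩
        (λ n → - g n) ⊛ i         ≋.∎
    }
    where
    module ≋ = ≋-Reasoning
    i : Series
    i = invₚ f
    fi≋1 : f ⊛ i ≋ 1ₚ
    fi≋1 = inv-inverse (constant p)
    fθi : f ⊛ θ i ≋ λ n → - g n
    fθi n = +-cancelʳ (g n) _ _ (begin
      (f ⊛ θ i) n + g n              ≈⟨ +-congˡ (S.*-identityʳ g n) ⟨
      (f ⊛ θ i) n + (g ⊛ 1ₚ) n       ≈⟨ +-congˡ (⊛-cong {f = g} S.refl fi≋1 n) ⟨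
      (f ⊛ θ i) n + (g ⊛ (f ⊛ i)) n  ≈⟨ +-congˡ (⊛-assoc g f i n) ⟨
      (f ⊛ θ i) n + (g ⊛ f ⊛ i) n    ≈⟨ +-congˡ (⊛-cong {g = i} (derivative p) S.refl n) ⟨
      (f ⊛ θ i) n + (θ f ⊛ i) n      ≈⟨ +-comm _ _ ⟩
      (θ f ⊛ i) n + (f ⊛ θ i) n      ≈⟨ θ-⊛ f i n ⟨
      θ (f ⊛ i) n                    ≈⟨ θ-cong fi≋1 n ⟩
      θ 1ₚ n                         ≈⟨ θ-1 n ⟩
      0#                             ≈⟨ -‿inverseˡ (g n) ⟨
      - g n + g n                    ∎)

  infixr 7 _•_
  -- Follows the case split of `_^ℤ_`, where a negative power is a positive power of the inverse.
  _•_ : ℤ → Carrier → Carrier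
  (+ k)    • x = k · x
  -[1+ k ] • x = suc k · (- x)

  log-exists : ∀ {f} → f 0 ≈ 1# → f HasLogDerivative θ f ⊛ invₚ f
  log-exists {f} f0 = record
    { constant   = f0
    ; derivative = S.sym (S.trans (⊛-assoc (θ f) (invₚ f) f)
        (S.trans (⊛-cong {f = θ f} S.refl (S.trans (⊛-comm (invₚ f) f) (inv-inverse f0)))
          (S.*-identityʳ (θ f))))
    }

  -- The hypothesis on c says that c k = 1 / k!.
  log-exp : ∀ {c f} → c 0 ≈ 1# → (∀ k → suc k · c (suc k) ≈ c k) → f 0 ≈ 0# →
            substituteₚ c f HasLogDerivative θ f
  log-exp {c} {f} c0 c-suc f0 = record
    { constant   = trans (substitute-0 c f) c0
    ; derivative = λ n → begin
        -- The sum is extended to n + 2 terms: θ kills the term k = 0, and c (k + 1) θ(f^(k+1)) = c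
        -- k θf f^k shifts the remaining n + 1.
        n · substituteₚ c f n
          ≈⟨ ×-congʳ n (substitute-truncate c f f0 {n} (ℕP.m<n⇒m<1+n ℕP.≤-refl)) ⟩
        n · Σ< (suc (suc n)) (λ k → c k * (f ^ₚ k) n)
          ≈⟨ ·-Σ< n (suc (suc n)) c (λ k → (f ^ₚ k) n) ⟩
        c 0 * θ 1ₚ n + Σ< (suc n) (λ k → c (suc k) * θ (f ^ₚ suc k) n)
          ≈⟨ +-cong (trans (*-congˡ (θ-1 n)) (zeroʳ _)) (Σ<-cong (suc n) (term n)) ⟩
        0# + Σ< (suc n) (λ k → c k * (θ f ⊛ f ^ₚ k) n)
          ≈⟨ +-identityˡ _ ⟩
        Σ< (suc n) (λ k → c k * (θ f ⊛ f ^ₚ k) n)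
          ≈⟨ ⊛-substitute c (θ f) f f0 n ⟨
        (θ f ⊛ substituteₚ c f) n ∎
    }
    where
    ·-Σ< : ∀ n N (a b : ℕ → Carrier) → n · Σ< N (λ k → a k * b k) ≈ Σ< N (λ k → a k * (n · b k))
    ·-Σ< n zero    a b = ·-zeroʳ n
    ·-Σ< n (suc N) a b = trans (×-distrib-+ _ _ n)
      (+-cong (sym (×-comm-* n _ _)) (·-Σ< n N (a ∘ suc) (b ∘ suc)))
    term : ∀ n k → c (suc k) * θ (f ^ₚ suc k) n ≈ c k * (θ f ⊛ f ^ₚ k) n
    term n k = trans (*-congˡ (θ-^ f k n)) (trans (×-comm-* (suc k) _ _)
      (trans (sym (×-assoc-* (suc k) _ _)) (*-congʳ (c-suc k))))

  -- θ multiplies the coefficient of t^(n+1) by n + 1, so without torsion only constants are killed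
  -- by it.
  constant-one : ∀ {f} → (∀ n x → suc n · x ≈ 0# → x ≈ 0#) → f HasLogDerivative 0ₚ → f ≋ 1ₚ
  constant-one torsionFree p zero    = constant p
  constant-one {f} torsionFree p (suc n) =
    torsionFree n (f (suc n)) (trans (derivative p (suc n)) (⊛-zeroˡ f (suc n)))

-- Finite sums.

module ListSums (R : CommutativeRing 0ℓ 0ℓ) where
  open CommutativeRing R hiding (zero)
  open SemiringSum semiring using (sum; sum-cong-≋; ∑-distrib-+; sum-replicate-zero; *-distribˡ-sum)
  open SemiringMult semiring using () renaming (_×_ to _·_)

  Σ[_] : ∀ {A : Set} → List A → (A → Carrier) → Carrier
  Σ[ xs ] f = List.foldr _+_ 0# (List.map f xs)

  Σ-cong : ∀ {A : Set} (xs : List A) {f g} → (∀ x → f x ≈ g x) → Σ[ xs ] f ≈ Σ[ xs ] g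
  Σ-cong []       p = refl
  Σ-cong (x ∷ xs) p = +-cong (p x) (Σ-cong xs p)

  Σ-zero : ∀ {A : Set} (xs : List A) {f} → (∀ x → f x ≈ 0#) → Σ[ xs ] f ≈ 0#
  Σ-zero []       p = refl
  Σ-zero (x ∷ xs) p = trans (+-cong (p x) (Σ-zero xs p)) (+-identityʳ 0#)

  -- Double negation commutes with finite conjunctions, so finitely many undecided equations may be
  -- assumed together.
  Σ-¬¬cong : ∀ {A : Set} (xs : List A) {f g} →
             (∀ x → ¬ ¬ (f x ≈ g x)) → ¬ ¬ (Σ[ xs ] f ≈ Σ[ xs ] g)
  Σ-¬¬cong []       p k = k refl
  Σ-¬¬cong (x ∷ xs) p k = p x λ fx≈gx → Σ-¬¬cong xs p λ fxs≈gxs → k (+-cong fx≈gx fxs≈gxs)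

  Σ-distrib-+ : ∀ {A : Set} (xs : List A) f g → Σ[ xs ] (λ x → f x + g x) ≈ Σ[ xs ] f + Σ[ xs ] g
  Σ-distrib-+ []       f g = sym (+-identityʳ 0#)
  Σ-distrib-+ (x ∷ xs) f g = trans (+-congˡ (Σ-distrib-+ xs f g)) (interchange (f x) (g x) _ _)
    where open CommutativeSemigroupProperties +-commutativeSemigroup using (interchange)

  *-distribˡ-Σ : ∀ {A : Set} (xs : List A) a f → a * Σ[ xs ] f ≈ Σ[ xs ] (λ x → a * f x)
  *-distribˡ-Σ []       a f = zeroʳ a
  *-distribˡ-Σ (x ∷ xs) a f = trans (distribˡ a (f x) _) (+-congˡ (*-distribˡ-Σ xs a f))

  sum-Σ-swap : ∀ {A : Set} {n} (xs : List A) (f : Fin n → A → Carrier) →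
               sum (λ i → Σ[ xs ] (f i)) ≈ Σ[ xs ] (λ x → sum λ i → f i x)
  sum-Σ-swap {n = n} []       f = sum-replicate-zero n
  sum-Σ-swap         (x ∷ xs) f =
    trans (∑-distrib-+ (λ i → f i x) (λ i → Σ[ xs ] (f i))) (+-congˡ (sum-Σ-swap xs f))

  -- Turns a sum over a filtered list into one over a full index range, where terms can be permuted.
  Σ-mapMaybe : ∀ {A B : Set} {n} (p : A → Maybe B) (h : Fin n → A) (g : B → Carrier) →
               Σ[ List.mapMaybe p (List.tabulate h) ] g ≈ sum λ i → maybe′ g 0# (p (h i))
  Σ-mapMaybe {n = zero}  p h g = refl
  Σ-mapMaybe {n = suc n} p h g with p (h zero)
  ... | just b  = +-congˡ (Σ-mapMaybe p (h ∘ suc) g)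
  ... | nothing = trans (Σ-mapMaybe p (h ∘ suc) g) (sym (+-identityˡ _))

  sum-indicator : ∀ {n} (S : Subset n) (f : Fin n → Carrier) →
                  (∀ i → i ∈ S → f i ≈ 1#) → (∀ i → i ∉ S → f i ≈ 0#) → sum f ≈ ∣ S ∣ · 1#
  sum-indicator []            f f∈ f∉ = refl
  sum-indicator (inside ∷ S)  f f∈ f∉ = +-cong (f∈ zero here)
    (sum-indicator S (f ∘ suc) (λ i i∈S → f∈ (suc i) (there i∈S))
      (λ i i∉S → f∉ (suc i) (i∉S ∘ drop-there)))
  sum-indicator (outside ∷ S) f f∈ f∉ = trans (+-cong (f∉ zero λ ())
    (sum-indicator S (f ∘ suc) (λ i i∈S → f∈ (suc i) (there i∈S))
      (λ i i∉S → f∉ (suc i) (i∉S ∘ drop-there)))) (+-identityˡ _)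

  -- Exchange of summation. With x a subgroup and i a group element, this pairs a relation in the
  -- group algebra with the function φ.
  Σ-*-sum : ∀ {A : Set} {n} (xs : List A) (a b : A → Carrier)
            (c : A → Fin n → Carrier) (φ : Fin n → Carrier) →
            (∀ x → b x ≈ sum λ i → c x i * φ i) → (∀ i → Σ[ xs ] (λ x → a x * c x i) ≈ 0#) →
            Σ[ xs ] (λ x → a x * b x) ≈ 0#
  Σ-*-sum {n = n} xs a b c φ b≈ ac≈0 = begin
    Σ[ xs ] (λ x → a x * b x)
      ≈⟨ Σ-cong xs (λ x → trans (*-congˡ (b≈ x)) (trans (*-distribˡ-sum (a x) (λ i → c x i * φ i))
           (sum-cong-≋ {n} λ i → x∙yz≈z∙xy (a x) (c x i) (φ i)))) ⟩
    Σ[ xs ] (λ x → sum {n} λ i → φ i * (a x * c x i))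
      ≈⟨ sum-Σ-swap xs (λ i x → φ i * (a x * c x i)) ⟨
    sum (λ i → Σ[ xs ] λ x → φ i * (a x * c x i))
      ≈⟨ sum-cong-≋ {n} (λ i → trans (sym (*-distribˡ-Σ xs (φ i) λ x → a x * c x i))
           (trans (*-congˡ (ac≈0 i)) (zeroʳ (φ i)))) ⟩
    sum {n} (λ _ → 0#)
      ≈⟨ sum-replicate-zero n ⟩
    0# ∎
    where
    open SetoidReasoning setoid
    open CommutativeSemigroupProperties *-commutativeSemigroup using (x∙yz≈z∙xy)

  Σ-*-affine : ∀ {A : Set} (xs : List A) (a b c : A → Carrier) g →
               Σ[ xs ] (λ x → a x * b x) ≈ 0# → Σ[ xs ] (λ x → a x * c x) ≈ 0# →
               Σ[ xs ] (λ x → a x * (b x + c x * g)) ≈ 0#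
  Σ-*-affine xs a b c g ab≈0 ac≈0 = begin
    Σ[ xs ] (λ x → a x * (b x + c x * g))
      ≈⟨ Σ-cong xs (λ x → trans (distribˡ _ _ _)
           (+-congˡ (trans (sym (*-assoc _ _ _)) (*-comm _ g)))) ⟩
    Σ[ xs ] (λ x → a x * b x + g * (a x * c x))
      ≈⟨ Σ-distrib-+ xs (λ x → a x * b x) (λ x → g * (a x * c x)) ⟩
    Σ[ xs ] (λ x → a x * b x) + Σ[ xs ] (λ x → g * (a x * c x))
      ≈⟨ +-cong ab≈0 (trans (sym (*-distribˡ-Σ xs g λ x → a x * c x)) (trans (*-congˡ ac≈0) (zeroʳ g))) ⟩
    0# + 0#
      ≈⟨ +-identityʳ 0# ⟩
    0# ∎
    where open SetoidReasoning setoid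

-- Integers and fractions inside ℂ.

module UniqueInverse (R : CommutativeRing 0ℓ 0ℓ) where
  open CommutativeRing R

  -- Serves for (k + 1) / (k + 1)! = 1 / k!, with b = k!, d = (k + 1)! and e = k + 1.
  cancel-inverse : ∀ {a b c d e} → a * b ≈ 1# → c * d ≈ 1# → d ≈ e * b → e * c ≈ a
  cancel-inverse {a} {b} {c} {d} {e} ab cd d≈eb = begin
    e * c              ≈⟨ *-identityˡ _ ⟨
    1# * (e * c)       ≈⟨ *-congʳ ab ⟨
    a * b * (e * c)    ≈⟨ *-assoc a b _ ⟩
    a * (b * (e * c))  ≈⟨ *-congˡ (*-assoc b e c) ⟨
    a * (b * e * c)    ≈⟨ *-congˡ (*-congʳ (trans (*-comm b e) (sym d≈eb))) ⟩
    a * (d * c)        ≈⟨ *-congˡ (trans (*-comm d c) cd) ⟩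
    a * 1#             ≈⟨ *-identityʳ a ⟩
    a                  ∎
    where open SetoidReasoning setoid

module ComplexNumbers where
  open CommutativeRing ℂ-commutativeRing hiding (zero)
  open Complexification ℝ-commutativeRing using (_,_)
  open SemiringMult semiring using () renaming (_×_ to _·_)
  open UniqueInverse ℂ-commutativeRing
  open FormalSeries ℂ-commutativeRing using (_•_)

  -- `a ℚ./ 1` divides by a gcd and is stuck for a variable a; this form is visibly in lowest terms,
  -- so sums and products compute.
  int : ℤ → ℚ.ℚ
  int a = ℚ.mkℚ a 0 (Coprimality.sym (Coprimality.1-coprimeTo ℤ.∣ a ∣))

  /1≡int : ∀ a → a ℚ./ 1 ≡ int a
  /1≡int a = ℚP.↥p/↧p≡p (int a)

  /1-+ : ∀ a b → (a ℤ.+ b) ℚ./ 1 ≡ a ℚ./ 1 ℚ.+ b ℚ./ 1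
  /1-+ a b = ≡.trans (≡.cong (ℚ._/ 1) (≡.sym (≡.cong₂ ℤ._+_ (ℤP.*-identityʳ a) (ℤP.*-identityʳ b))))
    (≡.sym (≡.cong₂ ℚ._+_ (/1≡int a) (/1≡int b)))

  /1-* : ∀ a b → (a ℤ.* b) ℚ./ 1 ≡ (a ℚ./ 1) ℚ.* (b ℚ./ 1)
  /1-* a b = ≡.sym (≡.cong₂ ℚ._*_ (/1≡int a) (/1≡int b))

  1/n*n : ∀ n .{{_ : ℕ.NonZero n}} → (+ 1 ℚ./ n) ℚ.* (+ n ℚ./ 1) ≡ ℚ.1ℚ
  1/n*n (suc m) = ℚP.toℚᵘ-injective (begin
    ℚ.toℚᵘ ((+ 1 ℚ./ suc m) ℚ.* (+ suc m ℚ./ 1))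
      ≈⟨ ℚP.toℚᵘ-homo-* (+ 1 ℚ./ suc m) (+ suc m ℚ./ 1) ⟩
    ℚ.toℚᵘ (+ 1 ℚ./ suc m) ℚᵘ.* ℚ.toℚᵘ (+ suc m ℚ./ 1)
      ≈⟨ ℚᵘP.*-cong (ℚP.toℚᵘ-fromℚᵘ (mkℚᵘ (+ 1) m)) (ℚP.toℚᵘ-fromℚᵘ (mkℚᵘ (+ suc m) 0)) ⟩
    mkℚᵘ (+ 1) m ℚᵘ.* mkℚᵘ (+ suc m) 0
      ≈⟨ *≡* (≡.trans (ℤP.*-identityʳ (+ 1 ℤ.* + suc m))
               (≡.cong (λ k → + 1 ℤ.* + k) (≡.sym (ℕP.*-identityʳ (suc m))))) ⟩
    ℚᵘ.1ℚᵘ ∎)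
    where open SetoidReasoning ℚᵘP.≃-setoid

  fromℚ-cong : ∀ {a b} → a ≡ b → fromℚ a ≈ fromℚ b
  fromℚ-cong ≡.refl = refl

  fromℚ-+ : ∀ a b → fromℚ (a ℚ.+ b) ≈ fromℚ a + fromℚ b
  fromℚ-+ a b = RealRing.pointwise (λ _ → ≡.refl) , RealRing.pointwise (λ _ → ≡.refl)

  fromℚ-* : ∀ a b → fromℚ (a ℚ.* b) ≈ fromℚ a * fromℚ b
  fromℚ-* a b = RealRing.pointwise (λ _ → ≡.sym (ℚP.+-identityʳ (a ℚ.* b)))
              , RealRing.pointwise (λ _ → ≡.sym (≡.cong₂ ℚ._+_ (ℚP.*-zeroʳ a) (ℚP.*-zeroˡ b)))

  fromℚ-neg : ∀ a → fromℚ (ℚ.- a) ≈ - fromℚ a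
  fromℚ-neg a = RealRing.pointwise (λ _ → ≡.refl) , RealRing.pointwise (λ _ → ≡.refl)

  fromℤ-+ : ∀ a b → fromℤ (a ℤ.+ b) ≈ fromℤ a + fromℤ b
  fromℤ-+ a b = trans (fromℚ-cong (/1-+ a b)) (fromℚ-+ (a ℚ./ 1) (b ℚ./ 1))

  fromℤ-* : ∀ a b → fromℤ (a ℤ.* b) ≈ fromℤ a * fromℤ b
  fromℤ-* a b = trans (fromℚ-cong (/1-* a b)) (fromℚ-* (a ℚ./ 1) (b ℚ./ 1))

  fromℤ-Σ : ∀ {A : Set} (xs : List A) f →
            fromℤ (List.foldr ℤ._+_ (+ 0) (List.map f xs)) ≈ ∑ xs λ x → fromℤ (f x)
  fromℤ-Σ []       f = refl
  fromℤ-Σ (x ∷ xs) f = trans (fromℤ-+ (f x) (List.foldr ℤ._+_ (+ 0) (List.map f xs)))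
    (+-congˡ {fromℤ (f x)} (fromℤ-Σ xs f))

  -- The real part is the constant sequence r. If r were nonzero, closeness to 0 within the
  -- tolerance |r| would give |r| < |r|.
  fromℤ≈0⇒≡0 : ∀ a → fromℤ a ≈ 0# → a ≡ + 0
  fromℤ≈0⇒≡0 a (re≈0 , _) = ≡.cong ℚ.↥_ (≡.trans (≡.sym (/1≡int a)) r≡0)
    where
    r : ℚ.ℚ
    r = a ℚ./ 1
    r≡0 : r ≡ ℚ.0ℚ
    r≡0 with r ℚP.≟ ℚ.0ℚ
    ... | yes p = p
    ... | no r≢0 =
      let N , close = _≈ℝ_.close re≈0 ℚ.∣ r ∣ 
            (ℚP.≰⇒> λ ∣r∣≤0 → r≢0 (ℚP.∣p∣≡0⇒p≡0 r (ℚP.≤-antisym ∣r∣≤0 (ℚP.0≤∣p∣ r))))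
      in contradiction (close N ℕP.≤-refl) (ℚP.<-irrefl (≡.cong ℚ.∣_∣ (ℚP.+-identityʳ r)))

  1≉0 : ¬ 1# ≈ 0#
  1≉0 p with () ← fromℤ≈0⇒≡0 (+ 1) p

  recip-inverse : ∀ n .{{_ : ℕ.NonZero n}} → recip n * fromℕ n ≈ 1#
  recip-inverse n = trans (sym (fromℚ-* (+ 1 ℚ./ n) (+ n ℚ./ 1))) (fromℚ-cong (1/n*n n))

  ·≈fromℕ* : ∀ n x → n · x ≈ fromℕ n * x
  ·≈fromℕ* zero    x = sym (zeroˡ x)
  ·≈fromℕ* (suc n) x = begin
    x + n · x                ≈⟨ +-cong (sym (*-identityˡ x)) (·≈fromℕ* n x) ⟩
    1# * x + fromℕ n * x     ≈⟨ distribʳ x 1# (fromℕ n) ⟨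
    (1# + fromℕ n) * x       ≈⟨ *-congʳ (fromℤ-+ (+ 1) (+ n)) ⟨
    fromℕ (suc n) * x        ∎
    where open SetoidReasoning setoid

  •≈fromℤ* : ∀ a x → a • x ≈ fromℤ a * x
  •≈fromℤ* (+ n)    x = ·≈fromℕ* n x
  •≈fromℤ* -[1+ n ] x = begin
    suc n · (- x)           ≈⟨ ·≈fromℕ* (suc n) (- x) ⟩
    fromℕ (suc n) * - x     ≈⟨ -‿distribʳ-* (fromℕ (suc n)) x ⟨
    - (fromℕ (suc n) * x)   ≈⟨ -‿distribˡ-* (fromℕ (suc n)) x ⟩
    - fromℕ (suc n) * x     ≈⟨ *-congʳ (fromℚ-neg (+ suc n ℚ./ 1)) ⟨
    fromℤ -[1+ n ] * x      ∎
    where open SetoidReasoning setoid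
          open RingProperties ring using (-‿distribʳ-*; -‿distribˡ-*)

  ·-cancel : ∀ n x → suc n · x ≈ 0# → x ≈ 0#
  ·-cancel n x p = begin
    x                                   ≈⟨ *-identityˡ x ⟨
    1# * x                              ≈⟨ *-congʳ (recip-inverse (suc n)) ⟨
    recip (suc n) * fromℕ (suc n) * x   ≈⟨ *-assoc _ _ x ⟩
    recip (suc n) * (fromℕ (suc n) * x) ≈⟨ *-congˡ (trans (sym (·≈fromℕ* (suc n) x)) p) ⟩
    recip (suc n) * 0#                  ≈⟨ zeroʳ _ ⟩
    0#                                  ∎
    where open SetoidReasoning setoid

  recip-factorial : ∀ k → suc k · recip (suc k !) {{suc k !≢0}} ≈ recip (k !) {{k !≢0}}
  recip-factorial k = trans (·≈fromℕ* (suc k) _)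
    (cancel-inverse (recip-inverse (k !) {{k !≢0}}) (recip-inverse (suc k !) {{suc k !≢0}})
      (trans (fromℚ-cong (≡.cong (ℚ._/ 1) (ℤP.pos-* (suc k) (k !)))) (fromℤ-* (+ suc k) (+ (k !)))))

-- Sums over a subgroup.

module SubgroupSums (R : CommutativeRing 0ℓ 0ℓ) {H : FiniteGroup} (M : Subgroup H) where
  open CommutativeRing R hiding (zero)
  open SemiringSum semiring using (sum; sum-cong-≋; sum-permute; *-distribˡ-sum)
  open SemiringMult semiring using () renaming (_×_ to _·_)
  open ListSums R
  open SetoidReasoning setoid
  private
    module H = FiniteGroup H
    module M = Group ⟨ M ⟩

  ∈-resp-≈ : ∀ {σ τ} → σ H.≈ τ → σ ∈ᴴ M → τ ∈ᴴ M
  ∈-resp-≈ σ≈τ = ≡.subst (_∈ Subgroup.subset M) (H.index-cong σ≈τ)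

  -- Written with the same `Maybe.map` as `elements`, so that `Σ-mapMaybe` applies directly.
  extendByZero : (M.Carrier → Carrier) → H.Carrier → Carrier
  extendByZero g σ = maybe′ g 0# (Maybe.map (σ ,_) (dec⇒maybe (σ ∈ᴴ? M)))

  Congruent : (M.Carrier → Carrier) → Set
  Congruent g = ∀ {σ τ} → σ M.≈ τ → g σ ≈ g τ

  extendByZero-elim : ∀ (P : Carrier → Set) g σ →
    (∀ σ∈M → P (g (σ , σ∈M))) → (¬ σ ∈ᴴ M → P 0#) → P (extendByZero g σ)
  extendByZero-elim P g σ inM outM with σ ∈ᴴ? M
  ... | yes σ∈M = inM σ∈M
  ... | no σ∉M  = outM σ∉M

  -- Congruence bridges the given membership proof and the one found by the decision procedure.
  extendByZero-∈ : ∀ {g} → Congruent g → ∀ {σ} (σ∈M : σ ∈ᴴ M) → extendByZero g σ ≈ g (σ , σ∈M)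
  extendByZero-∈ {g} g-cong {σ} σ∈M = extendByZero-elim (_≈ g (σ , σ∈M)) g σ
    (λ _ → g-cong H.refl) (contradiction σ∈M)

  extendByZero-∉ : ∀ g {σ} → ¬ σ ∈ᴴ M → extendByZero g σ ≈ 0#
  extendByZero-∉ g {σ} σ∉M = extendByZero-elim (_≈ 0#) g σ
    (λ σ∈M → contradiction σ∈M σ∉M) (λ _ → refl)

  ∑-elements : ∀ g → Σ[ elements M ] g ≈ sum λ i → extendByZero g (H.element i)
  ∑-elements = Σ-mapMaybe
    (λ i → Maybe.map (H.element i ,_) (dec⇒maybe (H.element i ∈ᴴ? M))) (λ i → i)

  ∑-elements-one : Σ[ elements M ] (λ _ → 1#) ≈ ∣ M ∣ᴴ · 1#
  ∑-elements-one = begin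
    Σ[ elements M ] (λ _ → 1#)
      ≈⟨ ∑-elements _ ⟩
    sum (λ i → extendByZero (λ _ → 1#) (H.element i))
      ≈⟨ sum-indicator S _
           (λ i i∈S → extendByZero-∈ {λ _ → 1#} (λ _ → refl)
             (≡.subst (_∈ S) (≡.sym (H.strictlyInverseˡ i)) i∈S))
           (λ i i∉S → extendByZero-∉ (λ _ → 1#)
             λ ∈M → i∉S (≡.subst (_∈ S) (H.strictlyInverseˡ i) ∈M)) ⟩
    ∣ M ∣ᴴ · 1# ∎
    where
    S : Subset H.order
    S = Subgroup.subset M

  leftTranslation : H.Carrier → Permutation′ H.order
  leftTranslation σ = permutation (λ i → H.index (σ H.∙ H.element i))
      (λ i → H.index (σ H.⁻¹ H.∙ H.element i))
      (λ i → inverse {σ} {σ H.⁻¹} i (H.inverseʳ σ)) (λ i → inverse {σ H.⁻¹} {σ} i (H.inverseˡ σ))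
    where
    inverse : ∀ {σ τ} i → σ H.∙ τ H.≈ H.ε → H.index (σ H.∙ H.element (H.index (τ H.∙ H.element i))) ≡ i
    inverse {σ} {τ} i στ≈ε = ≡.trans (H.index-cong (H.trans (H.∙-congˡ (H.strictlyInverseʳ _))
      (H.trans (H.sym (H.assoc σ τ _)) (H.trans (H.∙-congʳ στ≈ε) (H.identityˡ _)))))
      (H.strictlyInverseˡ i)

  -- Left translation by an element of M permutes H and preserves both M and its complement, hence
  -- is compatible with extension by zero.
  ∑-translate : ∀ {g} → Congruent g → ∀ σ →
                Σ[ elements M ] (λ τ → g (σ M.∙ τ)) ≈ Σ[ elements M ] g
  ∑-translate {g} g-cong (σ , σ∈M) = begin
    Σ[ elements M ] g∘σ                                    ≈⟨ ∑-elements g∘σ ⟩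
    sum (λ i → extendByZero g∘σ (H.element i))              ≈⟨ sum-cong-≋ term ⟩
    sum (λ i → extendByZero g (H.element (H.index (σ H.∙ H.element i))))
      ≈⟨ sum-permute (λ i → extendByZero g (H.element i)) (leftTranslation σ) ⟨
    sum (λ i → extendByZero g (H.element i))                ≈⟨ ∑-elements g ⟨
    Σ[ elements M ] g                                      ∎
    where
    g∘σ : M.Carrier → Carrier
    g∘σ τ = g ((σ , σ∈M) M.∙ τ)
    term : ∀ i → extendByZero g∘σ (H.element i) ≈ extendByZero g (H.element (H.index (σ H.∙ H.element i)))
    term i with H.element i ∈ᴴ? M
    ... | yes τ∈M = trans (g-cong (H.sym (H.strictlyInverseʳ _)))
      (sym (extendByZero-∈ g-cong (∈-resp-≈ (H.sym (H.strictlyInverseʳ _)) (∙-∈ M σ∈M τ∈M))))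
    ... | no τ∉M  = sym (extendByZero-∉ g λ στ∈M → τ∉M (∈-resp-≈
      (H.trans (H.sym (H.assoc _ _ _)) (H.trans (H.∙-congʳ (H.inverseˡ σ)) (H.identityˡ _)))
      (∙-∈ M (⁻¹-∈ M σ∈M) (∈-resp-≈ (H.strictlyInverseʳ _) στ∈M))))

  *-∑-elements : ∀ a g → a * Σ[ elements M ] g ≈ sum λ i → a * extendByZero g (H.element i)
  *-∑-elements a g = trans (*-congˡ (∑-elements g)) (*-distribˡ-sum a (λ i → extendByZero g (H.element i)))

-- Invariants of an irreducible representation.

module DotProducts (R : CommutativeRing 0ℓ 0ℓ) where
  open CommutativeRing R hiding (zero)
  open SemiringSum semiring using (sum; sum-cong-≋; ∑-distrib-+; *-distribˡ-sum; sum-replicate-zero)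
  open CommutativeSemigroupProperties *-commutativeSemigroup using (x∙yz≈y∙xz)
  open ListSums R

  infix 7 _∙_
  _∙_ : ∀ {n} → (Fin n → Carrier) → (Fin n → Carrier) → Carrier
  a ∙ v = sum λ k → a k * v k

  ∙-congˡ : ∀ {n} (a : Fin n → Carrier) {v w} → (∀ i → v i ≈ w i) → a ∙ v ≈ a ∙ w
  ∙-congˡ a v≈w = sum-cong-≋ λ k → *-congˡ {a k} (v≈w k)

  ∙-zeroʳ : ∀ {n} (a : Fin n → Carrier) → a ∙ (λ _ → 0#) ≈ 0#
  ∙-zeroʳ {n} a = trans (sum-cong-≋ λ k → zeroʳ (a k)) (sum-replicate-zero n)

  ∙-distribˡ : ∀ {n} (a v w : Fin n → Carrier) → a ∙ (λ i → v i + w i) ≈ a ∙ v + a ∙ w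
  ∙-distribˡ a v w = trans (sum-cong-≋ λ k → distribˡ (a k) (v k) (w k))
    (∑-distrib-+ (λ k → a k * v k) (λ k → a k * w k))

  ∙-scaleʳ : ∀ {n} (a : Fin n → Carrier) c v → a ∙ (λ i → c * v i) ≈ c * (a ∙ v)
  ∙-scaleʳ a c v = trans (sum-cong-≋ λ k → x∙yz≈y∙xz (a k) c (v k))
    (sym (*-distribˡ-sum c λ k → a k * v k))

  ∙-Σ : ∀ {A : Set} {n} (a : Fin n → Carrier) (xs : List A) (f : Fin n → A → Carrier) →
        a ∙ (λ k → Σ[ xs ] (f k)) ≈ Σ[ xs ] λ x → a ∙ (λ k → f k x)
  ∙-Σ a xs f = trans (sum-cong-≋ λ k → *-distribˡ-Σ xs (a k) (f k))
    (sum-Σ-swap xs λ k x → a k * f k x)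

  ∙-one : ∀ {n} (a : Fin n → Carrier) → a ∙ (λ _ → 1#) ≈ sum a
  ∙-one a = sum-cong-≋ λ k → *-identityʳ (a k)

module Irreducible {G : Group 0ℓ 0ℓ} (χ : IrreducibleCharacter G) where
  open CommutativeRing ℂ-commutativeRing hiding (zero)
  open SemiringSum semiring using (sum; sum-cong-≋)
  open DotProducts ℂ-commutativeRing using (∙-congˡ; ∙-zeroʳ; ∙-distribˡ; ∙-scaleʳ; ∙-one)
  open ComplexNumbers using (1≉0)
  open IrreducibleCharacter χ using (representation; irreducible; degree; ρ)
    renaming (χ to character)
  open IsIrreducible irreducible
  open InvariantSubspace using (IsFull)
  private module G = Group G

  invariants : InvariantSubspace representation
  invariants = record
    { _∈W    = λ v → ∀ σ i → (ρ σ ⊙ v) i ≈ v i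
    ; resp   = λ v≈w v∈ σ i → trans (∙-congˡ (ρ σ i) (λ j → sym (v≈w j))) (trans (v∈ σ i) (v≈w i))
    ; zero∈  = λ σ i → ∙-zeroʳ (ρ σ i)
    ; +-∈    = λ {v} {w} v∈ w∈ σ i → trans (∙-distribˡ (ρ σ i) v w) (+-cong (v∈ σ i) (w∈ σ i))
    ; *-∈    = λ c {v} v∈ σ i → trans (∙-scaleʳ (ρ σ i) c v) (*-congˡ {c} (v∈ σ i))
    ; stable = λ τ {v} v∈ σ i → trans (∙-congˡ (ρ σ i) (v∈ τ)) (trans (v∈ σ i) (sym (v∈ τ i)))
    }

  module _ (trivialAction : IsFull invariants) where

    -- Under a trivial action every subspace is stable; a coordinate hyperplane tests
    -- irreducibility.
    hyperplane : Fin degree → InvariantSubspace representation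
    hyperplane i = record
      { _∈W    = λ v → v i ≈ 0#
      ; resp   = λ v≈w v∈ → trans (sym (v≈w i)) v∈
      ; zero∈  = refl
      ; +-∈    = λ v∈ w∈ → trans (+-cong v∈ w∈) (+-identityʳ 0#)
      ; *-∈    = λ c v∈ → trans (*-congˡ {c} v∈) (zeroʳ c)
      ; stable = λ σ {v} v∈ → trans (trivialAction v σ i) v∈
      }

    e : Fin degree → Vecℂ degree
    e = identity degree

    e-diagonal : ∀ i → e i i ≈ 1#
    e-diagonal i with i FinP.≟ i
    ... | yes _  = refl
    ... | no i≢i = contradiction ≡.refl i≢i

    e-offDiagonal : ∀ {i j} → ¬ i ≡ j → e i j ≈ 0#
    e-offDiagonal {i} {j} i≢j with i FinP.≟ j
    ... | yes i≡j = contradiction i≡j i≢j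
    ... | no _    = refl

    -- If i and j differ, the hyperplane of i contains `e j` but not `e i`, so it is neither zero
    -- nor full.
    index-unique : ∀ i j → i ≡ j
    index-unique i j with i FinP.≟ j
    ... | yes i≡j = i≡j
    ... | no i≢j  = contradiction
      ( (λ isZero → 1≉0 (trans (sym (e-diagonal j))
          (isZero (e j) (e-offDiagonal λ j≡i → i≢j (≡.sym j≡i)) j)))
      , (λ isFull → 1≉0 (trans (sym (e-diagonal i)) (isFull (e i)))) )
      (simple (hyperplane i))

    -- With a single index, the trace is the sum of row `i₀`, that is, the `i₀`-entry of ρ(σ)
    -- applied to the all-ones vector, which is fixed.
    character-one : ∀ σ → character σ ≈ 1#
    character-one σ = trans
      (sum-cong-≋ λ k → reflexive (≡.cong (λ l → ρ σ l k) (index-unique k i₀)))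
      (trans (sym (∙-one (ρ σ i₀))) (trivialAction (λ _ → 1#) σ i₀))
      where
      i₀ : Fin degree
      i₀ = Fin.fromℕ< (ℕ.>-nonZero⁻¹ degree {{nonzero}})

  -- The average of ρ maps into the invariants, which are zero or everything.
  invariantSum≈0 : ∀ {A : Set} (xs : List A) (h : A → G.Carrier) →
    (∀ σ i j → (ρ σ ⊙ λ k → ∑ xs λ x → ρ (h x) k j) i ≈ ∑ xs λ x → ρ (h x) i j) →
    ¬ (∀ σ → character σ ≈ 1#) → ¬ ¬ (∑ xs (λ x → character (h x)) ≈ 0#)
  invariantSum≈0 xs h fixed nontrivial k = simple invariants
    -- By `fixed` each column of the summed matrix is an invariant vector; if only zero is
    -- invariant, the diagonal vanishes.
    ( (λ isZero → k (trans (sym (sum-Σ-swap xs λ i x → ρ (h x) i i))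
         (trans (sum-cong-≋ λ i → isZero (λ l → ∑ xs λ x → ρ (h x) l i) (λ σ l → fixed σ l i) i)
           (sum-replicate-zero degree))))
    , λ isFull → nontrivial (character-one isFull) )
    where
    open SemiringSum semiring using (sum-replicate-zero)
    open ListSums ℂ-commutativeRing using (sum-Σ-swap)

-- Averages of a character against functions on H.

module CharacterAverages {H : FiniteGroup} (M : Subgroup H) (χ : IrreducibleCharacter ⟨ M ⟩) where
  open CommutativeRing ℂ-commutativeRing hiding (zero)
  open SemiringSum semiring using (sum; sum-cong-≋)
  open ComplexNumbers
  open SubgroupSums ℂ-commutativeRing M
  open DotProducts ℂ-commutativeRing using (∙-Σ)
  open ListSums ℂ-commutativeRing
  open SetoidReasoning setoid
  private
    module H = FiniteGroup H
    module M = Group ⟨ M ⟩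
  open GroupProperties H.group using (⁻¹-involutive)
  open IrreducibleCharacter χ using (degree; ρ; ρ-cong; ρ-∙; χ⁻¹) renaming (χ to character)

  character-cong : ∀ {σ τ} → σ M.≈ τ → character σ ≈ character τ
  character-cong {σ} {τ} σ≈τ = sum-cong-≋ λ i → ρ-cong {σ} {τ} σ≈τ i i

  data Coefficient (σ : H.Carrier) : Carrier → Set where
    inside  : (σ∈M : σ ∈ᴴ M) → Coefficient σ (fromℕ degree * 1/∣ M ∣ * character ((σ , σ∈M) M.⁻¹))
    outside : ¬ σ ∈ᴴ M → Coefficient σ 0#

  coefficient : ∀ σ → Coefficient σ (idempotent M χ σ)
  coefficient σ with σ ∈ᴴ? M
  ... | yes σ∈M = inside σ∈M
  ... | no σ∉M  = outside σ∉M

  -- 1/|M| ∑ χ⁻¹(τ⁻¹) φ(τ), of which A_ν(χ⁻¹) is the case φ(τ) = Λ(τ ∘ F^ν)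
  -- and the multiplicity of the trivial character is the case φ = 1.
  average : (H.Carrier → Carrier) → Carrier
  average φ = 1/∣ M ∣ * ∑ (elements M) λ τ → χ⁻¹ (τ M.⁻¹) * φ (proj₁ τ)

  -- At τ both sides contain the trace of ρ((τ⁻¹)⁻¹), with possibly different membership proofs; off
  -- M both vanish.
  degree*average : ∀ φ → fromℕ degree * average φ
    ≈ sum λ i → idempotent M χ (H.element i H.⁻¹) * φ (H.element i)
  degree*average φ = trans (sym (*-assoc (fromℕ degree) 1/∣ M ∣ (Σ[ elements M ] g)))
    (trans (*-∑-elements a g) (sum-cong-≋ λ i → term (H.element i)))
    where
    g : M.Carrier → Carrier
    g τ = χ⁻¹ (τ M.⁻¹) * φ (proj₁ τ)
    a : Carrier
    a = fromℕ degree * 1/∣ M ∣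
    term : ∀ σ → a * extendByZero g σ ≈ idempotent M χ (σ H.⁻¹) * φ σ
    term σ = go (coefficient (σ H.⁻¹))
      where
      go : ∀ {c} → Coefficient (σ H.⁻¹) c → a * extendByZero g σ ≈ c * φ σ
      go (inside σ⁻¹∈M) = extendByZero-elim (λ z → a * z ≈ a * b * φ σ) g σ
        (λ σ∈M → trans
          (*-congˡ {a} (*-congʳ {φ σ}
            (character-cong {((σ , σ∈M) M.⁻¹) M.⁻¹} {(σ H.⁻¹ , σ⁻¹∈M) M.⁻¹} H.refl)))
          (sym (*-assoc a b (φ σ))))
        (contradiction (∈-resp-≈ (⁻¹-involutive σ) (⁻¹-∈ M σ⁻¹∈M)))
        where
        b : Carrier
        b = character ((σ H.⁻¹ , σ⁻¹∈M) M.⁻¹)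
      go (outside σ⁻¹∉M) = extendByZero-elim (λ z → a * z ≈ 0# * φ σ) g σ
        (λ σ∈M → contradiction (⁻¹-∈ M σ∈M) σ⁻¹∉M)
        (λ _ → trans (zeroʳ a) (sym (zeroˡ (φ σ))))

  -- As τ runs through M, so does στ.
  ∑-ρ-fixed : ∀ σ i j → (ρ σ ⊙ λ k → ∑ (elements M) λ τ → ρ τ k j) i ≈ ∑ (elements M) λ τ → ρ τ i j
  ∑-ρ-fixed σ i j = trans (∙-Σ (ρ σ i) (elements M) (λ k τ → ρ τ k j))
    (trans (Σ-cong (elements M) (λ τ → sym (ρ-∙ σ τ i j)))
      (∑-translate {λ τ → ρ τ i j} (λ {τ} {υ} τ≈υ → ρ-cong {τ} {υ} τ≈υ i j) σ))

  -- A refutation `k` of the equation also decides the case: a trivial character averages to |M| /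
  -- |M| = 1 and contradicts `k`, so the character is nontrivial and Schur's lemma applies.
  average-one : ∀ {u} → IsTrivialityIndicator χ⁻¹ u → ¬ ¬ (average (λ _ → 1#) ≈ fromℕ u)
  average-one {u} indicator k = sum-zero λ ∑χ≈0 → k
    (trans (*-congˡ {1/∣ M ∣} (trans (Σ-cong (elements M) character-inv-inv) ∑χ≈0))
      (trans (zeroʳ 1/∣ M ∣) (reflexive (≡.cong fromℕ (≡.sym (nontrivial ¬trivial))))))
    where
    open IsTrivialityIndicator indicator
    ¬trivial : ¬ (∀ τ → χ⁻¹ τ ≈ 1#)
    ¬trivial one = k (trans (*-congˡ {1/∣ M ∣} (begin
        ∑ (elements M) (λ τ → χ⁻¹ (τ M.⁻¹) * 1#)
          ≈⟨ Σ-cong (elements M) (λ τ → trans (*-identityʳ (χ⁻¹ (τ M.⁻¹))) (one (τ M.⁻¹))) ⟩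
        ∑ (elements M) (λ _ → 1#)
          ≈⟨ ∑-elements-one ⟩
        _
          ≈⟨ ·≈fromℕ* ∣ M ∣ᴴ 1# ⟩
        fromℕ ∣ M ∣ᴴ * 1#
          ≈⟨ *-identityʳ (fromℕ ∣ M ∣ᴴ) ⟩
        fromℕ ∣ M ∣ᴴ ∎))
      (trans (recip-inverse ∣ M ∣ᴴ {{∣M∣≢0 M}}) (reflexive (≡.cong fromℕ (≡.sym (trivial one))))))
    character-inv-inv : ∀ τ → χ⁻¹ (τ M.⁻¹) * 1# ≈ character τ
    character-inv-inv τ = trans (*-identityʳ (χ⁻¹ (τ M.⁻¹)))
      (character-cong {(τ M.⁻¹) M.⁻¹} {τ} (⁻¹-involutive (proj₁ τ)))
    sum-zero : ¬ ¬ (∑ (elements M) character ≈ 0#)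
    sum-zero = Irreducible.invariantSum≈0 χ (elements M) (λ τ → τ) ∑-ρ-fixed
      λ one → ¬trivial λ τ → one (τ M.⁻¹)

-- Logarithmic derivatives of L and P.

module LogarithmicDerivatives where
  open CommutativeRing ℂ-commutativeRing hiding (zero)
  open SemiringSum semiring using (sum-cong-≋)
  open SemiringMult semiring using () renaming (_×_ to _·_)
  open MonoidMult +-commutativeMonoid using (×-distrib-+)
  open ComplexNumbers
  open FormalSeries ℂ-commutativeRing

  -- The two products of series agree by computation, but the two units only coefficient by
  -- coefficient; hence the comparison of powers and substitutions.
  1ₚ≋1ₛ : 1ₚ ≋ 1ₛ
  1ₚ≋1ₛ zero    = refl
  1ₚ≋1ₛ (suc n) = refl

  ^ₚ≋^ₛ : ∀ {f g} → f ≋ g → ∀ k → f ^ₚ k ≋ g ^ₛ k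
  ^ₚ≋^ₛ         f≋g zero    = 1ₚ≋1ₛ
  ^ₚ≋^ₛ {f} {g} f≋g (suc k) = ⊛-cong {f} {g} f≋g (^ₚ≋^ₛ {f} {g} f≋g k)

  substituteₚ≋substitute : ∀ c {f g} → f ≋ g → substituteₚ c f ≋ substitute c g
  substituteₚ≋substitute c {f} {g} f≋g n = sum-cong-≋ {suc n} λ k →
    *-congˡ {c (Fin.toℕ k)} (^ₚ≋^ₛ {f} {g} f≋g (Fin.toℕ k) n)

  1/_! : Series
  1/ k ! = recip (k !) {{k !≢0}}

  1/0! : 1/ 0 ! ≈ 1#
  1/0! = refl

  log-substitute : ∀ {c f f′ g} → f ≋ f′ → substituteₚ c f HasLogDerivative g →
                   substitute c f′ HasLogDerivative g
  log-substitute {c} {f} {f′} f≋f′ = log-resp (substituteₚ≋substitute c {f} {f′} f≋f′)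

  log-expₛ : ∀ {f} → f 0 ≈ 0# → expₛ f HasLogDerivative θ f
  log-expₛ {f} f0 = log-substitute {1/_!} {f} {f} (λ n → refl)
    (log-exp {1/_!} {f} 1/0! recip-factorial f0)

  log-1ₛ : 1ₛ HasLogDerivative 0ₚ
  log-1ₛ = log-resp 1ₚ≋1ₛ log-1

  log-*ₛ : ∀ {f f′ g g′} → f HasLogDerivative g → f′ HasLogDerivative g′ →
           f *ₛ f′ HasLogDerivative g ⊕ g′
  log-*ₛ {f} {f′} {g} {g′} p p′ = log-⊛ {f} {f′} {g} {g′} p p′

  log-^ₛ : ∀ {f g} → f HasLogDerivative g → ∀ k → f ^ₛ k HasLogDerivative λ n → k · g n
  log-^ₛ p zero    = log-1ₛ
  log-^ₛ p (suc k) = log-*ₛ p (log-^ₛ p k)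

  log-inverseₛ : ∀ {f g} → f HasLogDerivative g → inverseₛ f HasLogDerivative λ n → - g n
  log-inverseₛ {f} {g} p = log-substitute {λ _ → 1#} {_} {_} 1-f (log-inv {f} {g} p)
    where
    1-f : (λ n → 1ₚ n - f n) ≋ λ n → 1ₛ n - f n
    1-f zero    = refl
    1-f (suc n) = refl

  log-^ℤ : ∀ {f g} → f HasLogDerivative g → ∀ z → f ^ℤ z HasLogDerivative λ n → fromℤ z * g n
  log-^ℤ {f} {g} p z = log-cong (λ n → •≈fromℤ* z (g n)) (go z)
    where
    go : ∀ z → f ^ℤ z HasLogDerivative λ n → z • g n
    go (+ k)    = log-^ₛ p k
    go -[1+ k ] = log-^ₛ (log-inverseₛ p) (suc k)

  log-∏ₛ : ∀ {A : Set} (xs : List A) {f g : A → Series} → (∀ x → f x HasLogDerivative g x) →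
           ∏ₛ xs f HasLogDerivative λ n → ∑ xs λ x → g x n
  log-∏ₛ []       p = log-1ₛ
  log-∏ₛ (x ∷ xs) p = log-*ₛ (p x) (log-∏ₛ xs p)

  -- Left as a quotient: being the same series for every M, it factors out of the sum over
  -- subgroups.
  logDerivative-1- : Carrier → Series
  logDerivative-1- c = θ (1- c t) ⊛ invₚ (1- c t)

  log-1- : ∀ c → (1- c t) HasLogDerivative logDerivative-1- c
  log-1- c = log-exists {1- c t} (refl {1#})

  logDerivative-poles : ℕ → Series
  logDerivative-poles q = logDerivative-1- (fromℕ q) ⊕ logDerivative-1- 1#

  log-L : ∀ {H} Λ (M : Subgroup H) χ → L {H} Λ M χ HasLogDerivative θ (logL {H} Λ M χ)
  log-L {H} Λ M χ = log-expₛ {logL {H} Λ M χ} (refl {0#})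

  module _ {H : FiniteGroup} (Λ : FiniteGroup.Carrier H → ℕ → ℕ) (M : Subgroup H)
           (χ : Group.Carrier ⟨ M ⟩ → Carrier) (q u : ℕ) where
    private
      X Y logX logY : Series
      X = (1- fromℕ q t) ^ₛ u
      Y = (1- 1# t) ^ₛ u
      logX n = u · logDerivative-1- (fromℕ q) n
      logY n = u · logDerivative-1- 1# n

    log-P : P {H} Λ M χ q u HasLogDerivative
              λ n → θ (logL {H} Λ M χ) n + fromℕ u * logDerivative-poles q n
    log-P = log-cong scale
      (log-*ₛ {L {H} Λ M χ} {X *ₛ Y} {θ (logL {H} Λ M χ)} {logX ⊕ logY} (log-L {H} Λ M χ)
        (log-*ₛ {X} {Y} {logX} {logY} (log-^ₛ (log-1- (fromℕ q)) u) (log-^ₛ (log-1- 1#) u)))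
      where
      scale : θ (logL {H} Λ M χ) ⊕ (logX ⊕ logY)
                ≋ λ n → θ (logL {H} Λ M χ) n + fromℕ u * logDerivative-poles q n
      scale n = +-congˡ {θ (logL {H} Λ M χ) n} (trans
        (sym (×-distrib-+ (logDerivative-1- (fromℕ q) n) (logDerivative-1- 1# n) u))
        (·≈fromℕ* u (logDerivative-poles q n)))

  -- θ cancels the denominators ν of log L. Index 0 is left out, since `logL` has 0 there instead of
  -- `A 0`.
  θ-logL : ∀ {H} Λ (M : Subgroup H) χ n → θ (logL {H} Λ M χ) (suc n) ≈ A {H} Λ M χ (suc n)
  θ-logL {H} Λ M χ n = trans (·≈fromℕ* (suc n) (a * recip (suc n))) (begin
    fromℕ (suc n) * (a * recip (suc n))  ≈⟨ x∙yz≈y∙zx (fromℕ (suc n)) a (recip (suc n)) ⟩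
    a * (recip (suc n) * fromℕ (suc n))  ≈⟨ *-congˡ {a} (recip-inverse (suc n)) ⟩
    a * 1#                               ≈⟨ *-identityʳ a ⟩
    a                                    ∎)
    where
    open SetoidReasoning setoid
    open CommutativeSemigroupProperties *-commutativeSemigroup using (x∙yz≈y∙zx)
    a : Carrier
    a = A {H} Λ M χ (suc n)

-- From the relation between idempotents to the product formula.

module _ {H : FiniteGroup} (χ : (M : Subgroup H) → IrreducibleCharacter ⟨ M ⟩)
         (s : Subgroup H → ℤ) where
  open CommutativeRing ℂ-commutativeRing hiding (zero)
  open ComplexNumbers
  open ListSums ℂ-commutativeRing
  open IrreducibleCharacter using (degree; χ⁻¹)
  open CharacterAverages using (average; degree*average; average-one)
  open CommutativeSemigroupProperties *-commutativeSemigroup using (xy∙z≈y∙xz)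
  open LogarithmicDerivatives
  open FormalSeries ℂ-commutativeRing
    using (Series; _≋_; _HasLogDerivative_; 0ₚ; 1ₚ; θ; constant-one; log-cong)
  private module H = FiniteGroup H

  multiplicity : Subgroup H → ℤ
  multiplicity M = + degree (χ M) ℤ.* s M

  module _ (relation : ∀ σ → ∑ (subgroups H) (λ M → fromℤ (s M) * idempotent M (χ M) σ) ≈ 0#) where

    ∑-average : ∀ φ → ∑ (subgroups H) (λ M → fromℤ (multiplicity M) * average M (χ M) φ) ≈ 0#
    ∑-average φ = trans
      (Σ-cong (subgroups H) λ M → trans
        (*-congʳ {average M (χ M) φ} (fromℤ-* (+ degree (χ M)) (s M)))
        (xy∙z≈y∙xz (fromℕ (degree (χ M))) (fromℤ (s M)) (average M (χ M) φ)))
      (Σ-*-sum (subgroups H) (λ M → fromℤ (s M)) (λ M → fromℕ (degree (χ M)) * average M (χ M) φ)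
        (λ M i → idempotent M (χ M) (H.element i H.⁻¹)) (λ i → φ (H.element i))
        (λ M → degree*average M (χ M) φ) (λ i → relation (H.element i H.⁻¹)))

    module _ (u : Subgroup H → ℕ) (indicator : ∀ M → IsTrivialityIndicator (χ⁻¹ (χ M)) (u M)) where

      -- Whether a character is trivial is undecidable, but this equation between
      -- integers may be proved as if it were decidable.
      ∑-poles : ∑ (subgroups H) (λ M → fromℤ (multiplicity M) * fromℕ (u M)) ≈ 0#
      ∑-poles = trans (sym ∑z≈) (reflexive (≡.cong fromℤ z≡0))
        where
        z : ℤ
        z = List.foldr ℤ._+_ (+ 0) (List.map (λ M → multiplicity M ℤ.* + u M) (subgroups H))
        ∑z≈ : fromℤ z ≈ ∑ (subgroups H) λ M → fromℤ (multiplicity M) * fromℕ (u M)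
        ∑z≈ = trans (fromℤ-Σ (subgroups H) λ M → multiplicity M ℤ.* + u M)
          (Σ-cong (subgroups H) λ M → fromℤ-* (multiplicity M) (+ u M))
        z≡0 : z ≡ + 0
        -- For each M, u_M may be replaced by the average of the constant 1; the relation for φ = 1
        -- then contradicts `z≢0`.
        z≡0 = decidable-stable (z ℤP.≟ + 0) λ z≢0 →
          Σ-¬¬cong (subgroups H)
            (λ M k → average-one M (χ M) (indicator M) λ p → k (*-congˡ {fromℤ (multiplicity M)} p))
            λ p → z≢0 (fromℤ≈0⇒≡0 z (trans ∑z≈ (trans (sym p) (∑-average λ _ → 1#))))

      module _ (Λ : H.Carrier → ℕ → ℕ) (q : ℕ) where
        factor logFactor : Subgroup H → Series
        factor M = P {H} Λ M (χ⁻¹ (χ M)) q (u M)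
        logFactor M n = θ (logL {H} Λ M (χ⁻¹ (χ M))) n + fromℕ (u M) * logDerivative-poles q n

        product : Series
        product = ∏ₛ (subgroups H) λ M → factor M ^ℤ multiplicity M

        log-product : product HasLogDerivative
          λ n → ∑ (subgroups H) λ M → fromℤ (multiplicity M) * logFactor M n
        log-product = log-∏ₛ (subgroups H) {λ M → factor M ^ℤ multiplicity M}
          {λ M n → fromℤ (multiplicity M) * logFactor M n}
          λ M → log-^ℤ {factor M} {logFactor M} (log-P {H} Λ M (χ⁻¹ (χ M)) q (u M)) (multiplicity M)

        ∑-θ-logL : ∀ n →
          ∑ (subgroups H) (λ M → fromℤ (multiplicity M) * θ (logL {H} Λ M (χ⁻¹ (χ M))) n) ≈ 0#
        ∑-θ-logL zero    = Σ-zero (subgroups H) λ M → zeroʳ (fromℤ (multiplicity M))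
        ∑-θ-logL (suc n) = trans
          (Σ-cong (subgroups H) λ M → *-congˡ {fromℤ (multiplicity M)} (θ-logL {H} Λ M (χ⁻¹ (χ M)) n))
          (∑-average λ σ → fromℕ (Λ σ (suc n)))

        ∑-logFactor : (λ n → ∑ (subgroups H) λ M → fromℤ (multiplicity M) * logFactor M n) ≋ 0ₚ
        ∑-logFactor n = Σ-*-affine (subgroups H) (λ M → fromℤ (multiplicity M))
          (λ M → θ (logL {H} Λ M (χ⁻¹ (χ M))) n) (λ M → fromℕ (u M)) (logDerivative-poles q n)
          (∑-θ-logL n) ∑-poles

        product≈1 : product ≈ₛ 1ₛ
        product≈1 n = trans
          (constant-one {product} ·-cancel (log-cong {product}
             {λ n → ∑ (subgroups H) λ M → fromℤ (multiplicity M) * logFactor M n} {0ₚ}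
             ∑-logFactor log-product) n)
          (1ₚ≋1ₛ n)

open import Data.Integer.Base using (_*_)
open CommutativeRing ℂ-commutativeRing using (_≈_; 0#) renaming (_*_ to _·_)
open FiniteGroup using (Carrier; order)
open IrreducibleCharacter using (χ⁻¹; degree)

theorem3 :
  ∀ {p q : ℕ} → Prime p →
  (k : FiniteField p q) (k̄ : AlgebraicClosure k)
  (H : FiniteGroup) → Coprime (order H) p →
  ContainsRootsOfUnity k̄ (order H) →
  (Y : Curve k̄) (action : FaithfulAction k̄ H Y)
  (Λ : Carrier H → ℕ → ℕ) → CountsFixedPoints k̄ action Λ →
  (χ : (M : Subgroup H) → IrreducibleCharacter ⟨ M ⟩)
  (u : Subgroup H → ℕ) → (∀ M → IsTrivialityIndicator (χ⁻¹ (χ M)) (u M)) →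
  (s : Subgroup H → ℤ) →
  (∀ σ → ∑ (subgroups H) (λ M → fromℤ (s M) · idempotent M (χ M) σ) ≈ 0#) →
  ∏ₛ (subgroups H) (λ M → P Λ M (χ⁻¹ (χ M)) q (u M) ^ℤ (+ degree (χ M) * s M)) ≈ₛ 1ₛ
theorem3 {q = q} _ _ _ _ _ _ _ _ Λ _ χ u indicator s relation =
  product≈1 χ s relation u indicator Λ q
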